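{- Let $\ell\ge 3$ be a fixed integer and let $H=C_{2\ell-1}$ be the cycle of length $2\ell-1$. Then for all sufficiently large $n$, $$\mathrm{ex}_r(n, C_{2\ell-1})=\begin{cases} \frac n2 & \text{if } n \text{ is even},\\ 2 \left\lfloor \frac n{2\ell+1} \right\rfloor & \text{if } n \text{ is odd}.\end{cases}$$
   Context: For a graph $H$ and a positive integer $n$, the regular Turán number $\mathrm{ex}_r(n,H)$ is the maximum integer $k$ such that there exists a $k$-regular graph $G$ on $n$ vertices that does not contain $H$ as a (not necessarily induced) subgraph. Graphs are finite and simple. -}

module Defs where

open import Data.Nat using (ℕ; zero; suc; _+_; _*_; _∸_; _/_; _%_; _≤_)
open import Data.Bool using (Bool; true; false)
open import Data.Fin using (Fin; zero; suc; fromℕ; inject₁)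
open import Data.List using (List; length; filter; allFin)
open import Data.Product using (Σ; _×_; _,_; ∃)
open import Relation.Binary.PropositionalEquality using (_≡_; _≢_)
open import Function.Definitions using (Injective)
open import Data.Bool.Properties using (T?)
open import Data.Bool using (T)
open import Relation.Nullary using (¬_)

record Graph (n : ℕ) : Set where
  field
    adj       : Fin n → Fin n → Bool
    symmetric : ∀ u v → adj u v ≡ adj v u
    loopless  : ∀ v → adj v v ≡ false
open Graph public

degree : ∀ {n} → Graph n → Fin n → ℕ
degree {n} G v = length (filter (λ u → T? (adj G v u)) (allFin n))

Regular : ∀ {n} → ℕ → Graph n → Set
Regular k G = ∀ v → degree G v ≡ k

cycSuc : ∀ {m} → Fin (suc m) → Fin (suc m)
cycSuc {zero}  zero    = zero
cycSuc {suc m} zero    = suc zero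
cycSuc {suc m} (suc i) with cycSuc {m} i
... | zero  = zero
... | suc j = suc (suc j)

-- ContainsCycleSuc m G: G contains the cycle of length (suc m) as a (not
-- necessarily induced) subgraph: an injective vertex map f : Fin (suc m) → Fin n
-- with f i adjacent to f (i+1 mod (suc m)).  (Only used with suc m ≥ 5.)
ContainsCycleSuc : ∀ {n} → ℕ → Graph n → Set
ContainsCycleSuc {n} m G =
  Σ (Fin (suc m) → Fin n) λ f →
    Injective _≡_ _≡_ f × (∀ i → T (adj G (f i) (f (cycSuc i))))

IsRegTuranCycle : ℕ → ℕ → ℕ → Set
IsRegTuranCycle n m k =
  (Σ (Graph n) λ G → Regular k G × ¬ ContainsCycleSuc m G)
  × (∀ d (G : Graph n) → Regular d G → ¬ ContainsCycleSuc m G → d ≤ k)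

{-# OPTIONS --safe #-}
module Submission where

-- Call two vertices linked (R) if they have at least 3ℓ common neighbours.  Let G be d-regular on
-- n vertices with (2ℓ+1)d > 2n, n large and no C_{2ℓ-1}; then among any ℓ+1 vertices two are linked.
--
-- There is no path of odd length g between linked vertices a, b.  If g + 2 ≤ 2ℓ-1, replace a, b by
-- linked common neighbours of a and b, lengthening the path by 2, until it closes to a C_{2ℓ-1}.
-- Otherwise a shortest such path closes to a cycle of odd length W = g + 2 ≥ 2ℓ+1.  By minimality linked
-- vertices of the cycle are at distance 2, so linkedness among ℓ+1 suitable vertices forces
-- W = 2ℓ+1 and makes all pairs at distance 2 linked; then no vertex has three neighbours
-- on the cycle, and (2ℓ+1)d ≤ 2n.
--
-- Hence G is bipartite: grow a 2-connected two-coloured subgraph from a linked pair by adding ears.  An ear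
-- of the wrong parity would give an odd path between linked vertices, so growth stops only at a cut vertex.
-- Regularity rules out proper bipartite end blocks, because counting edges from both sides shows that d divides
-- the degree of the cut vertex inside the block.
--
-- The extremal graph for odd n = (2ℓ+1)e + r is a modified blow-up of C_{2ℓ+1} with class sizes e, e ± r.

open import Defs
open import Data.Bool using (Bool; true; false; not; _∧_; _∨_; _xor_; if_then_else_; T)
open import Data.Bool.Properties using (T?; T-≡; ∧-comm; ∧-zeroʳ; ∨-comm; xor-comm; xor-same; ¬-not; not-involutive; not-injective) renaming (_≟_ to _≟ᵇ_)
open import Data.Bool.Solver using (module xor-∧-Solver)
open import Data.Empty using (⊥; ⊥-elim)
open import Data.Fin using (Fin; zero; suc; toℕ; fromℕ<; _↑ˡ_; _↑ʳ_; splitAt)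
import Data.Fin.Properties as Fin
open import Data.List using (List; []; _∷_; _++_; length; filter; tabulate; applyUpTo)
open import Data.List.Properties using (length-applyUpTo)
import Data.List.Membership.DecPropositional as DecMembership
open import Data.List.Membership.Propositional using (_∈_; _∉_)
open import Data.List.Membership.Propositional.Properties using (∈-applyUpTo⁺; ∈-applyUpTo⁻; ∈-++⁻)
open import Data.List.Relation.Unary.Any using (here; there)
open import Data.Nat
open import Data.Nat.Divisibility using (_∣_; _∣0; ∣-refl; ∣⇒≤; ∣m∣n⇒∣m+n; ∣m+n∣m⇒∣n; ∣n⇒∣m*n)
open import Data.Nat.DivMod using (m≡m%n+[m/n]*n; m%n<n; m<n⇒m%n≡m; [m+n]%n≡m%n; [m+kn]%n≡m%n; n%n≡0; m*n/n≡m; /-monoˡ-≤)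
open import Data.Nat.Induction using (<-rec)
open import Data.Nat.Properties
open import Data.Nat.Tactic.RingSolver using (solve-∀)
open import Data.Product using (Σ; ∃; ∃₂; _×_; _,_; proj₁; proj₂)
open import Data.Sum using (_⊎_; inj₁; inj₂; [_,_]′)
open import Function using (_∘_; Equivalence)
open import Relation.Binary.Definitions using (tri<; tri≈; tri>)
open import Relation.Binary.PropositionalEquality
open import Relation.Nullary using (¬_; Dec; yes; no; does; contradiction)
open import Relation.Nullary.Decidable using (_×-dec_; ¬?; dec-true; dec-false)
open import Algebra.Properties.CommutativeMonoid.Sum +-0-commutativeMonoid using (sum; sum-cong-≗; ∑-distrib-+; ∑-comm; sum-replicate-zero)

-- The constant 3ℓ is the price of lengthening a path: at most 2ℓ - 2 path vertices are avoided, and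
-- ℓ + 1 further common neighbours must remain so that two of them are linked.
--
-- Parity is controlled only for paths between linked vertices. The growing subgraph therefore
-- carries the invariant that any two of its vertices reach the two ends of some linked pair by
-- disjoint paths, of total length of the parity prescribed by the colours.
--
-- At a cut vertex the obstacle is that its degree inside a piece is unknown. The induction
-- therefore runs over vertex sets with one exceptional vertex, whose degree need not be a multiple
-- of d. Colouring one piece shows that d divides the degree of the cut vertex there, and
-- subtraction gives the same for the other piece.
--
-- Bipartiteness settles both upper bounds: a d-regular bipartite graph with d > 0 has two classes
-- of equal size, at least d each. So d is at most n/2, and n cannot be odd.

⟦_⟧ : Bool → ℕ
⟦ true ⟧  = 1
⟦ false ⟧ = 0

⟦⟧≤1 : ∀ b → ⟦ b ⟧ ≤ 1
⟦⟧≤1 true  = s≤s z≤n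
⟦⟧≤1 false = z≤n

-- Counting and sums over finite sets.

count : ∀ {n} → (Fin n → Bool) → ℕ
count b = sum (λ i → ⟦ b i ⟧)

sum-mono : ∀ {n} {f g : Fin n → ℕ} → (∀ i → f i ≤ g i) → sum f ≤ sum g
sum-mono {zero}  h = z≤n
sum-mono {suc n} h = +-mono-≤ (h zero) (sum-mono (h ∘ suc))

sum-const : ∀ n c → sum {n} (λ _ → c) ≡ n * c
sum-const zero    c = refl
sum-const (suc n) c = cong (c +_) (sum-const n c)

sum-≡0 : ∀ {n} {f : Fin n → ℕ} → (∀ i → f i ≡ 0) → sum f ≡ 0
sum-≡0 {n} h = trans (sum-cong-≗ h) (sum-replicate-zero n)

sum-*ˡ : ∀ {n} c (f : Fin n → ℕ) → sum (λ i → c * f i) ≡ c * sum f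
sum-*ˡ {zero}  c f = sym (*-zeroʳ c)
sum-*ˡ {suc n} c f = trans (cong (c * f zero +_) (sum-*ˡ c (f ∘ suc))) (sym (*-distribˡ-+ c (f zero) _))

sum-single : ∀ {n} (f : Fin n → ℕ) k → (∀ i → i ≢ k → f i ≡ 0) → sum f ≡ f k
sum-single f zero    h = trans (cong (f zero +_) (sum-≡0 (λ i → h (suc i) λ ()))) (+-identityʳ _)
sum-single f (suc k) h =
  cong₂ _+_ (h zero λ ()) (sum-single (f ∘ suc) k λ i i≢k → h (suc i) (i≢k ∘ Fin.suc-injective))

term≤sum : ∀ {n} (f : Fin n → ℕ) k → f k ≤ sum f
term≤sum f zero    = m≤m+n _ _
term≤sum f (suc k) = ≤-trans (term≤sum (f ∘ suc) k) (m≤n+m _ _)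

count-mono : ∀ {n} {b c : Fin n → Bool} → (∀ i → b i ≡ true → c i ≡ true) → count b ≤ count c
count-mono {b = b} {c} h = sum-mono λ i → aux i (b i) refl
  where
  aux : ∀ i x → b i ≡ x → ⟦ x ⟧ ≤ ⟦ c i ⟧
  aux i true  e rewrite h i e = ≤-refl
  aux i false e = z≤n

count-cong : ∀ {n} {b c : Fin n → Bool} → (∀ i → b i ≡ c i) → count b ≡ count c
count-cong h = sum-cong-≗ (cong ⟦_⟧ ∘ h)

count-mono-< : ∀ {n} {b c : Fin n → Bool} → (∀ i → b i ≡ true → c i ≡ true) →
               ∀ k → b k ≡ false → c k ≡ true → count b < count c
count-mono-< {suc n} {b} {c} h zero bk ck rewrite bk | ck = s≤s (count-mono (h ∘ suc))
count-mono-< {suc n} {b} {c} h (suc k) bk ck with b zero in e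
... | false = ≤-trans (count-mono-< (h ∘ suc) k bk ck) (m≤n+m _ _)
... | true rewrite h zero e = s≤s (count-mono-< (h ∘ suc) k bk ck)

count≤n : ∀ {n} (b : Fin n → Bool) → count b ≤ n
count≤n {n} b = ≤-trans (sum-mono (⟦⟧≤1 ∘ b)) (≤-reflexive (trans (sum-const n 1) (*-identityʳ n)))

count-witness : ∀ {n} (b : Fin n → Bool) → 0 < count b → ∃ λ i → b i ≡ true
count-witness {suc n} b pos with b zero in e
... | true  = zero , e
... | false = let i , p = count-witness (b ∘ suc) pos in suc i , p

length-filter-tabulate : ∀ {m n} (b : Fin n → Bool) (f : Fin m → Fin n) →
  length (filter (λ u → T? (b u)) (tabulate f)) ≡ count (b ∘ f)
length-filter-tabulate {zero}  b f = refl
length-filter-tabulate {suc m} b f with b (f zero)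
... | true  = cong suc (length-filter-tabulate b (f ∘ suc))
... | false = length-filter-tabulate b (f ∘ suc)

degree≡count : ∀ {n} (G : Graph n) v → degree G v ≡ count (adj G v)
degree≡count G v = length-filter-tabulate (adj G v) (λ i → i)

-- Splitting off the first row and column leaves a smaller symmetric matrix and twice the first row.
handshake : ∀ {n} (f : Fin n → Fin n → ℕ) → (∀ i j → f i j ≡ f j i) → (∀ i → f i i ≡ 0) →
            ∃ λ k → sum (λ i → sum (f i)) ≡ k + k
handshake {zero}  f s l = 0 , refl
handshake {suc n} f s l with handshake (λ i j → f (suc i) (suc j)) (λ i j → s (suc i) (suc j)) (l ∘ suc)
... | k , e = r + k , (begin
    (f zero zero + r) + sum (λ i → f (suc i) zero + sum (f (suc i) ∘ suc))
      ≡⟨ cong₂ _+_ (cong (_+ r) (l zero)) (∑-distrib-+ (λ i → f (suc i) zero) _) ⟩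
    r + (sum (λ i → f (suc i) zero) + sum (λ i → sum (f (suc i) ∘ suc)))
      ≡⟨ cong (r +_) (cong₂ _+_ (sum-cong-≗ λ i → s (suc i) zero) e) ⟩
    r + (r + (k + k))
      ≡⟨ shuffle r k ⟩
    (r + k) + (r + k) ∎)
  where
  open ≡-Reasoning
  r = sum (f zero ∘ suc)
  shuffle : ∀ r k → r + (r + (k + k)) ≡ (r + k) + (r + k)
  shuffle = solve-∀

-- Parity and Boolean bookkeeping.

odd : ℕ → Bool
odd zero    = false
odd (suc k) = not (odd k)

odd-+ : ∀ a b → odd (a + b) ≡ odd a xor odd b
odd-+ zero    b = refl
odd-+ (suc a) b rewrite odd-+ a b with odd a
... | true  = not-involutive (odd b)
... | false = refl

odd-double : ∀ a → odd (a + a) ≡ false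
odd-double a rewrite odd-+ a a with odd a
... | true  = refl
... | false = refl

half : ∀ x → odd x ≡ false → ∃ λ j → x ≡ j + j
half zero          _ = 0 , refl
half (suc (suc x)) e with half x (trans (sym (not-involutive (odd x))) e)
... | j , refl = suc j , cong suc (sym (+-suc j j))

half-odd : ∀ x → odd x ≡ true → ∃ λ j → x ≡ suc (j + j)
half-odd (suc x) o = let j , q = half x (trans (sym (not-involutive (odd x))) (cong not o)) in j , cong suc q

odd-2* : ∀ x → odd (2 * x) ≡ false
odd-2* x = trans (cong (λ z → odd (x + z)) (+-identityʳ x)) (odd-double x)

odd-* : ∀ a b → odd (a * b) ≡ odd a ∧ odd b
odd-* zero    b = refl
odd-* (suc a) b = trans (odd-+ b (a * b)) (trans (cong (odd b xor_) (odd-* a b)) (lemma (odd a) (odd b)))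
  where
  lemma : ∀ x y → y xor (x ∧ y) ≡ not x ∧ y
  lemma true  true  = refl
  lemma true  false = refl
  lemma false true  = refl
  lemma false false = refl

∧-true : ∀ {a b} → a ∧ b ≡ true → a ≡ true × b ≡ true
∧-true {true} {true} _ = refl , refl

true-∧ : ∀ {a b} → a ≡ true → b ≡ true → a ∧ b ≡ true
true-∧ refl refl = refl

∨-true : ∀ {a b} → a ∨ b ≡ true → a ≡ true ⊎ b ≡ true
∨-true {true}  _ = inj₁ refl
∨-true {false} e = inj₂ e

true-∨ʳ : ∀ a {b} → b ≡ true → a ∨ b ≡ true
true-∨ʳ true  _ = refl
true-∨ʳ false e = e

true-∨ˡ : ∀ {a b} → a ≡ true → a ∨ b ≡ true
true-∨ˡ refl = refl

clash : ∀ {b} {A : Set} → b ≡ true → b ≡ false → A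
clash refl ()

not-true : ∀ {b} → not b ≡ true → b ≡ false
not-true {false} _ = refl

does-≡ : ∀ {n} {u v : Fin n} → does (u Fin.≟ v) ≡ true → u ≡ v
does-≡ {u = u} {v} e with u Fin.≟ v
... | yes q = q

does-refl : ∀ {n} (v : Fin n) → does (v Fin.≟ v) ≡ true
does-refl v with v Fin.≟ v
... | yes _ = refl
... | no ¬e = contradiction refl ¬e

does-≢ : ∀ {n} {u v : Fin n} → u ≢ v → does (u Fin.≟ v) ≡ false
does-≢ {u = u} {v} u≢v with u Fin.≟ v
... | yes e = contradiction e u≢v
... | no _  = refl

≡ᵇ-true : ∀ {i j} → (i ≡ᵇ j) ≡ true → i ≡ j
≡ᵇ-true {i} {j} e = ≡ᵇ⇒≡ i j (Equivalence.from T-≡ e)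

-- Choosing fresh elements of a set.

count-remove : ∀ {n} (b : Fin n → Bool) x →
               count b ≤ suc (count (λ z → b z ∧ not (does (z Fin.≟ x))))
count-remove {n} b x = ≤-trans (sum-mono pointwise) (≤-reflexive
  (trans (∑-distrib-+ (λ z → ⟦ does (z Fin.≟ x) ⟧) _) (cong (_+ count b′) one)))
  where
  b′ : Fin n → Bool
  b′ z = b z ∧ not (does (z Fin.≟ x))
  pointwise : ∀ z → ⟦ b z ⟧ ≤ ⟦ does (z Fin.≟ x) ⟧ + ⟦ b′ z ⟧
  pointwise z with z Fin.≟ x | b z
  ... | yes _ | true  = s≤s z≤n
  ... | yes _ | false = z≤n
  ... | no _  | true  = ≤-refl
  ... | no _  | false = z≤n
  one : sum (λ z → ⟦ does (z Fin.≟ x) ⟧) ≡ 1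
  one = trans (sum-single _ x off) on
    where
    off : ∀ z → z ≢ x → ⟦ does (z Fin.≟ x) ⟧ ≡ 0
    off z z≢x with z Fin.≟ x
    ... | yes e = contradiction e z≢x
    ... | no _  = refl
    on : ⟦ does (x Fin.≟ x) ⟧ ≡ 1
    on with x Fin.≟ x
    ... | yes _ = refl
    ... | no ¬e = contradiction refl ¬e

fresh : ∀ {n} (b : Fin n → Bool) (ex : List (Fin n)) → length ex < count b →
        ∃ λ z → b z ≡ true × z ∉ ex
fresh b [] lt = let z , bz = count-witness b lt in z , bz , λ ()
fresh b (x ∷ ex) lt
  with fresh (λ z → b z ∧ not (does (z Fin.≟ x))) ex (s≤s⁻¹ (≤-trans lt (count-remove b x)))
... | z , b′z , z∉ with z Fin.≟ x
...   | yes _  = contradiction (proj₂ (∧-true {b z} b′z)) λ ()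
...   | no z≢x = z , proj₁ (∧-true b′z) , λ { (here e) → z≢x e ; (there m) → z∉ m }

freshes : ∀ {n} (b : Fin n → Bool) → Fin n → ∀ t (ex : List (Fin n)) → length ex + t ≤ count b →
          ∃ λ (x : ℕ → Fin n) → (∀ i → i < t → b (x i) ≡ true × x i ∉ ex) ×
                                (∀ i j → i < j → j < t → x i ≢ x j)
-- `v` only fills the indices from `t` on: families of vertices are total functions on ℕ, the form
-- that `R-pair` takes.
freshes b v zero    ex le = (λ _ → v) , (λ _ ()) , (λ _ _ _ ())
freshes {n} b v (suc t) ex le
  with fresh b ex (≤-trans (s≤s (m≤m+n _ t)) (≤-trans (≤-reflexive (sym (+-suc _ t))) le))
... | z , bz , z∉ with freshes b v t (z ∷ ex) (≤-trans (≤-reflexive (sym (+-suc _ t))) le)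
... | x , good , inj = y , good′ , inj′
  where
  y : ℕ → Fin n
  y zero    = z
  y (suc i) = x i
  good′ : ∀ i → i < suc t → b (y i) ≡ true × y i ∉ ex
  good′ zero    _       = bz , z∉
  good′ (suc i) (s≤s l) = proj₁ (good i l) , proj₂ (good i l) ∘ there
  inj′ : ∀ i j → i < j → j < suc t → y i ≢ y j
  inj′ zero    (suc j) _       (s≤s m) e = proj₂ (good j m) (here (sym e))
  inj′ (suc i) (suc j) (s≤s l) (s≤s m) e = inj i j l m e

pick₂ : ∀ {W} (b : Fin W → Bool) → 1 < count b →
        ∃₂ λ i j → toℕ i < toℕ j × b i ≡ true × b j ≡ true
pick₂ {suc W} b l with b zero in e
... | true  = let j , q = count-witness (b ∘ suc) (s≤s⁻¹ l) in zero , suc j , s≤s z≤n , e , q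
... | false = let i , j , u , p , q = pick₂ (b ∘ suc) l in suc i , suc j , s≤s u , p , q

pick₃ : ∀ {W} (b : Fin W → Bool) → 2 < count b →
        ∃ λ i → ∃₂ λ j k → toℕ i < toℕ j × toℕ j < toℕ k × b i ≡ true × b j ≡ true × b k ≡ true
pick₃ {suc W} b l with b zero in e
... | true  = let j , k , v , q , r = pick₂ (b ∘ suc) (s≤s⁻¹ l) in
              zero , suc j , suc k , s≤s z≤n , s≤s v , e , q , r
... | false = let i , j , k , u , v , p , q , r = pick₃ (b ∘ suc) l in
              suc i , suc j , suc k , s≤s u , s≤s v , p , q , r

∣-sum : ∀ {n d} (f : Fin n → ℕ) → (∀ i → d ∣ f i) → d ∣ sum f
∣-sum {zero}  {d} f h = d ∣0
∣-sum {suc n} f h = ∣m∣n⇒∣m+n (h zero) (∣-sum (f ∘ suc) (h ∘ suc))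

-- All other terms can be subtracted one at a time. This isolates the degree of a single exceptional
-- vertex.
∣-sum-rest : ∀ {n d} (f : Fin n → ℕ) k → (∀ i → i ≢ k → d ∣ f i) → d ∣ sum f → d ∣ f k
∣-sum-rest {d = d} f zero    h D = ∣m+n∣m⇒∣n (subst (d ∣_) (+-comm (f zero) _) D) (∣-sum (f ∘ suc) λ i → h (suc i) λ ())
∣-sum-rest f (suc k) h D = ∣-sum-rest (f ∘ suc) k (λ i i≢k → h (suc i) (i≢k ∘ Fin.suc-injective))
                             (∣m+n∣m⇒∣n D (h zero λ ()))

cycSuc-step : ∀ {m} (i : Fin (suc m)) → toℕ i < m → toℕ (cycSuc i) ≡ suc (toℕ i)
cycSuc-step {suc m} zero    _       = refl
cycSuc-step {suc m} (suc i) (s≤s l) with cycSuc i | cycSuc-step i l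
... | zero  | ()
... | suc j | e = cong suc e

cycSuc-last : ∀ {m} (i : Fin (suc m)) → toℕ i ≡ m → cycSuc i ≡ zero
cycSuc-last {zero}  zero    _ = refl
cycSuc-last {suc m} (suc i) e with cycSuc i | cycSuc-last i (suc-injective e)
... | zero | _ = refl

2ℓ∸2+2 : ∀ {ℓ} → 3 ≤ ℓ → 2 * ℓ ∸ 2 + 2 ≡ 2 * ℓ
2ℓ∸2+2 {ℓ} 3≤ℓ = m∸n+n≡m {2 * ℓ} {2} (≤-trans (s≤s (s≤s z≤n)) (*-monoʳ-≤ 2 (≤-trans (s≤s z≤n) 3≤ℓ)))

-- Paths and cycles

module Paths {n : ℕ} (G : Graph n) where

  V : Set
  V = Fin n

  Adj : V → V → Set
  Adj u v = adj G u v ≡ true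

  Adj-sym : ∀ {u v} → Adj u v → Adj v u
  Adj-sym {u} {v} a = trans (symmetric G v u) a

  Adj-irrefl : ∀ {v} → ¬ Adj v v
  Adj-irrefl {v} a = contradiction (trans (sym (loopless G v)) a) λ ()

  Adj⇒≢ : ∀ {u v} → Adj u v → u ≢ v
  Adj⇒≢ a refl = Adj-irrefl a

  common : V → V → V → Bool
  common u v w = adj G u w ∧ adj G v w

  -- Only the values of `p` at 0, ..., `g` are constrained. With total functions, suffixes and
  -- reversals are precompositions with index arithmetic.
  record Path (g : ℕ) (p : ℕ → V) : Set where
    field
      edge     : ∀ i → i < g → Adj (p i) (p (suc i))
      distinct : ∀ i j → i < j → j ≤ g → p i ≢ p j
  open Path public

  infixr 5 _▸_
  _▸_ : V → (ℕ → V) → ℕ → V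
  (v ▸ p) zero    = v
  (v ▸ p) (suc i) = p i

  prepend : ∀ {g p v} → Path g p → Adj v (p 0) → (∀ i → i ≤ g → v ≢ p i) → Path (suc g) (v ▸ p)
  prepend {g} {p} {v} P a new = record { edge = e ; distinct = d }
    where
    e : ∀ i → i < suc g → Adj ((v ▸ p) i) (p i)
    e zero    _       = a
    e (suc i) (s≤s l) = edge P i l
    d : ∀ i j → i < j → j ≤ suc g → (v ▸ p) i ≢ (v ▸ p) j
    d zero    (suc j) _       (s≤s m) = new j m
    d (suc i) (suc j) (s≤s l) (s≤s m) = distinct P i j l m

  suffix : ∀ {g p} i k → Path g p → i + k ≤ g → Path k (λ t → p (i + t))
  suffix {g} {p} i k P le = record
    { edge     = λ t l → subst (λ s → Adj (p (i + t)) (p s)) (sym (+-suc i t))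
                   (edge P (i + t) (≤-trans (+-monoʳ-< i l) le))
    ; distinct = λ s t l m → distinct P (i + s) (i + t) (+-monoʳ-< i l) (≤-trans (+-monoʳ-≤ i m) le)
    }

  reversePath : ∀ {g p} → Path g p → Path g (λ i → p (g ∸ i))
  reversePath {g} {p} P = record { edge = e ; distinct = d }
    where
    e : ∀ i → i < g → Adj (p (g ∸ i)) (p (g ∸ suc i))
    e i l = Adj-sym (subst (λ s → Adj (p (g ∸ suc i)) (p s)) (sym (+-∸-assoc 1 l))
              (edge P (g ∸ suc i) (∸-monoʳ-< (s≤s z≤n) l)))
    d : ∀ i j → i < j → j ≤ g → p (g ∸ i) ≢ p (g ∸ j)
    d i j l m q = distinct P (g ∸ j) (g ∸ i) (∸-monoʳ-< l m) (m∸n≤m g i) (sym q)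

  cycle-of : ∀ {m q} → Path m q → Adj (q m) (q 0) → ContainsCycleSuc m G
  cycle-of {m} {q} P a = (λ i → q (toℕ i)) , inj , step
    where
    inj : ∀ {i j : Fin (suc m)} → q (toℕ i) ≡ q (toℕ j) → i ≡ j
    inj {i} {j} e with <-cmp (toℕ i) (toℕ j)
    ... | tri< l _ _ = contradiction e (distinct P _ _ l (s≤s⁻¹ (Fin.toℕ<n j)))
    ... | tri≈ _ t _ = Fin.toℕ-injective t
    ... | tri> _ _ l = contradiction (sym e) (distinct P _ _ l (s≤s⁻¹ (Fin.toℕ<n i)))
    step : ∀ i → T (adj G (q (toℕ i)) (q (toℕ (cycSuc i))))
    step i with m≤n⇒m<n∨m≡n (s≤s⁻¹ (Fin.toℕ<n i))
    ... | inj₁ l rewrite cycSuc-step i l = Equivalence.from T-≡ (edge P _ l)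
    ... | inj₂ e rewrite cycSuc-last i e | e = Equivalence.from T-≡ a

  vertices : ℕ → (ℕ → V) → List V
  vertices g p = applyUpTo p (suc g)

  fresh-≢ : ∀ {g p z} → z ∉ vertices g p → ∀ i → i ≤ g → z ≢ p i
  fresh-≢ {p = p} z∉ i l refl = z∉ (∈-applyUpTo⁺ p (s≤s l))

  -- A periodic function allows an arc to start at any index and run past the origin without a case
  -- distinction.
  record Cycle (W : ℕ) (c : ℕ → V) : Set where
    field
      periodic : ∀ i → c (i + W) ≡ c i
      cedge    : ∀ i → Adj (c i) (c (suc i))
      cdist    : ∀ i t → 0 < t → t < W → c i ≢ c (i + t)
  open Cycle public

  arc : ∀ {W c} → Cycle W c → ∀ i k → k < W → Path k (λ t → c (i + t))
  arc {W} {c} C i k l = record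
    { edge     = λ t _ → subst (λ s → Adj (c (i + t)) (c s)) (sym (+-suc i t)) (cedge C (i + t))
    ; distinct = λ s t s<t t≤k e → cdist C (i + s) (t ∸ s) (m<n⇒0<n∸m s<t)
                   (≤-trans (s≤s (m∸n≤m t s)) (≤-trans (s≤s t≤k) l))
                   (trans e (cong c (trans (cong (i +_) (sym (m+[n∸m]≡n (<⇒≤ s<t)))) (sym (+-assoc i s _)))))
    }

  closePath : ∀ {m q} → Path m q → Adj (q m) (q 0) → Cycle (suc m) (λ i → q (i % suc m))
  closePath {m} {q} P a = record { periodic = λ i → cong q ([m+n]%n≡m%n i W) ; cedge = e ; cdist = d }
    where
    W = suc m
    e : ∀ i → Adj (q (i % W)) (q (suc i % W))
    e i with m≤n⇒m<n∨m≡n (s≤s⁻¹ (m%n<n i W))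
    ... | inj₁ l = subst (λ s → Adj (q (i % W)) (q s)) (sym next) (edge P _ l)
      where
      next : suc i % W ≡ suc (i % W)
      next = trans (cong (λ s → suc s % W) (m≡m%n+[m/n]*n i W))
             (trans ([m+kn]%n≡m%n (suc (i % W)) (i / W) W) (m<n⇒m%n≡m (s≤s l)))
    ... | inj₂ f = subst₂ (λ s t → Adj (q s) (q t)) (sym f) (sym next) a
      where
      next : suc i % W ≡ 0
      next = trans (cong (λ s → suc s % W) (m≡m%n+[m/n]*n i W))
             (trans ([m+kn]%n≡m%n (suc (i % W)) (i / W) W) (trans (cong (λ s → suc s % W) f) (n%n≡0 W)))
    d : ∀ i t → 0 < t → t < W → q (i % W) ≢ q ((i + t) % W)
    d i t pos lt eq with <-cmp (i % W) ((i + t) % W)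
    ... | tri< l _ _ = distinct P _ _ l (s≤s⁻¹ (m%n<n (i + t) W)) eq
    ... | tri> _ _ l = distinct P _ _ l (s≤s⁻¹ (m%n<n i W)) (sym eq)
    -- With equal residues, `i + t < i + W` keeps the quotient of `i + t` at most that of `i`,
    -- whence `i + t ≤ i`, against `0 < t`.
    ... | tri≈ _ r _ = <-irrefl refl (<-≤-trans (m<m+n i pos) j≤i)
      where
      x = i / W
      y = (i + t) / W
      i+t< : (i + t) % W + y * W < i % W + suc x * W
      i+t< = begin-strict
        (i + t) % W + y * W   ≡⟨ m≡m%n+[m/n]*n (i + t) W ⟨
        i + t                 <⟨ +-monoʳ-< i lt ⟩
        i + W                 ≡⟨ cong (_+ W) (m≡m%n+[m/n]*n i W) ⟩
        i % W + x * W + W     ≡⟨ +-assoc (i % W) _ _ ⟩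
        i % W + (x * W + W)   ≡⟨ cong (i % W +_) (+-comm (x * W) W) ⟩
        i % W + suc x * W     ∎
        where open ≤-Reasoning
      y≤x : y ≤ x
      y≤x = s≤s⁻¹ (*-cancelʳ-< W y (suc x) (+-cancelˡ-< (i % W) _ _ (subst (λ s → s + y * W < i % W + suc x * W) (sym r) i+t<)))
      j≤i : i + t ≤ i
      j≤i = begin
        i + t               ≡⟨ m≡m%n+[m/n]*n (i + t) W ⟩
        (i + t) % W + y * W ≤⟨ +-mono-≤ (≤-reflexive (sym r)) (*-monoˡ-≤ W y≤x) ⟩
        i % W + x * W       ≡⟨ m≡m%n+[m/n]*n i W ⟨
        i                   ∎
        where open ≤-Reasoning

-- Paths with explicit vertex lists, and how to cut them.

module SimplePaths {n : ℕ} (G : Graph n) where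

  open Paths G

  -- The inductive counterpart of `Path`. The list in the type makes disjointness and containment in
  -- a vertex set easy to express when paths are cut and joined.
  data SP : V → V → ℕ → List V → Set where
    stop : ∀ {v} → SP v v 0 (v ∷ [])
    step : ∀ {u v w k vs} → Adj u v → u ∉ vs → SP v w k vs → SP u w (suc k) (u ∷ vs)

  Disjoint : List V → List V → Set
  Disjoint us vs = ∀ {v} → v ∈ us → v ∈ vs → ⊥

  start∈ : ∀ {u w k vs} → SP u w k vs → u ∈ vs
  start∈ stop         = here refl
  start∈ (step _ _ _) = here refl

  append : ∀ {a b c e i j ps qs} → SP a b i ps → Adj b c → SP c e j qs → Disjoint ps qs →
           SP a e (i + suc j) (ps ++ qs)
  append stop           b~c q dis = step b~c (dis (here refl)) q
  append {ps = _ ∷ ps} (step a~ a∉ p) b~c q dis =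
    step a~ (λ m → case-∈ (∈-++⁻ ps m)) (append p b~c q (dis ∘ there))
    where
    case-∈ : _ ∈ ps ⊎ _ ∈ _ → ⊥
    case-∈ (inj₁ m) = a∉ m
    case-∈ (inj₂ m) = dis (here refl) m

  -- Here the two starts are adjacent, not an end and a start: the first path is moved vertex by
  -- vertex onto the front of the second.
  append-reversed : ∀ {a s c e i j ps qs} → SP a s i ps → Adj a c → SP c e j qs → Disjoint ps qs →
                    ∃ λ vs → SP s e (i + suc j) vs
  append-reversed stop a~c q dis = _ , step a~c (dis (here refl)) q
  append-reversed {s = s} {e = e} {suc i} {j} (step a~b a∉ p) a~c q dis
    with append-reversed p (Adj-sym a~b) (step a~c (dis (here refl)) q)
           (λ { m (here refl) → a∉ m ; m (there m′) → dis (there m) m′ })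
  ... | vs , r = vs , subst (λ k → SP s e k vs) (+-suc i (suc j)) r

  SP⇒Path : ∀ {u w k vs} → SP u w k vs →
            ∃ λ p → Path k p × p 0 ≡ u × p k ≡ w × (∀ i → i ≤ k → p i ∈ vs)
  SP⇒Path {u} stop = (λ _ → u) , record { edge = λ _ () ; distinct = λ { _ zero () _ ; _ (suc _) _ () } } ,
                     refl , refl , λ _ _ → here refl
  SP⇒Path {u} {k = suc k} {vs = _ ∷ vs} (step u~v u∉ r) with SP⇒Path r
  ... | p , P , refl , e , p∈ = (u ▸ p) ,
    prepend P u~v (λ i i≤k u≡ → u∉ (subst (_∈ vs) (sym u≡) (p∈ i i≤k))) , refl , e , ∈-cons
    where
    ∈-cons : ∀ i → i ≤ suc k → (u ▸ p) i ∈ u ∷ vs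
    ∈-cons zero    _       = here refl
    ∈-cons (suc i) (s≤s l) = there (p∈ i l)

  length-SP : ∀ {u w k vs} → SP u w k vs → length vs ≡ suc k
  length-SP stop         = refl
  length-SP (step _ _ p) = cong suc (length-SP p)

  -- On the vertex list of a path this is the distance, along the path, from `v` to the end. Its
  -- parity will colour the vertices of an ear.
  after : List V → V → ℕ
  after []       v = 0
  after (u ∷ us) v = if does (u Fin.≟ v) then length us else after us v

  after-head : ∀ {u w k vs} → SP u w k vs → after vs u ≡ k
  after-head {u} stop rewrite does-refl u = refl
  after-head {u} (step _ _ p) rewrite does-refl u = length-SP p

  tail-path : ∀ {u w k vs v} → SP u w k vs → v ∈ vs →
              ∃ λ ts → SP v w (after vs v) ts × (∀ {x} → x ∈ ts → x ∈ vs)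
  tail-path {vs = vs} p (here refl) with p
  ... | stop        = vs , subst (λ k → SP _ _ k vs) (sym (after-head p)) p , λ m → m
  ... | step _ _ _  = vs , subst (λ k → SP _ _ k vs) (sym (after-head p)) p , λ m → m
  tail-path {u} {vs = vs} {v} p@(step _ _ q) (there m) with u Fin.≟ v
  ... | yes refl = vs , subst (λ k → SP _ _ k vs) (sym (length-SP q)) p , λ m → m
  ... | no  _    = let ts , t , sub = tail-path q m in ts , t , there ∘ sub

  -- The accumulator is the path walked so far, traversed backwards from the current vertex.
  module _ {e w : V} where

    head-path : ∀ {u i k hs us v} → SP u e i hs → SP u w k us →
                (∀ {x} → x ∈ hs → x ∈ us → x ≡ u) → v ∈ us →
                ∃₂ λ h hs′ → SP v e h hs′ × (∀ {x} → x ∈ hs′ → x ∈ hs ⊎ x ∈ us) × h + after us v ≡ i + k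
    head-path {i = i} acc p@stop dis (here refl) = _ , _ , acc , inj₁ , cong (i +_) (after-head p)
    head-path {i = i} acc p@(step _ _ _) dis (here refl) = _ , _ , acc , inj₁ , cong (i +_) (after-head p)
    head-path {u} {i} {suc k} {hs} {_ ∷ us} {v} acc (step a u∉ p) dis (there m)
      with head-path (step (Adj-sym a) (λ y∈ → u∉ (subst (_∈ us) (dis y∈ (there (start∈ p))) (start∈ p))) acc) p
             (λ { (here e) _ → e ; (there y∈) z∈ → contradiction (subst (_∈ us) (dis y∈ (there z∈)) z∈) u∉ }) m
    ... | h , hs′ , q , sub , len = h , hs′ , q , sub′ , trans (cong (h +_) skip) (trans len (sym (+-suc i k)))
      where
      skip : after (u ∷ us) v ≡ after us v
      skip rewrite does-≢ {u = u} {v} (λ { refl → u∉ m }) = refl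
      sub′ : ∀ {x} → x ∈ hs′ → x ∈ hs ⊎ x ∈ u ∷ us
      sub′ x∈ with sub x∈
      ... | inj₁ (here refl) = inj₂ (there (start∈ p))
      ... | inj₁ (there y)   = inj₁ y
      ... | inj₂ y           = inj₂ (there y)

    -- The outer pieces of a path from `e` to `w` on which `v` comes before `v′`: from `v` back to
    -- `e`, and from `v′` on to `w`. Two vertices of an ear leave it this way without meeting.
    record Split (es : List V) (len : ℕ) (v v′ : V) : Set where
      field
        {hlen} : ℕ
        {hs ts} : List V
        headₛ  : SP v e hlen hs
        tailₛ  : SP v′ w (after es v′) ts
        hlen≡  : hlen + after es v ≡ len
        apart  : Disjoint hs ts

    private
      SplitIn : List V → List V → ℕ → V → V → Set
      SplitIn hs us len v v′ = Σ (Split us len v v′) λ S →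
        (∀ {x} → x ∈ Split.hs S → x ∈ hs ⊎ x ∈ us) × (∀ {x} → x ∈ Split.ts S → x ∈ us)

      lift-split : ∀ {u y i k hs us v v′} → u ∉ us → y ∈ us → v ∈ us → v′ ∈ us →
                   SplitIn (y ∷ hs) us (suc i + k) v v′ → SplitIn hs (u ∷ us) (i + suc k) v v′
      lift-split {u} {y} {i} {k} {hs} {us} {v} {v′} u∉ y∈ m m′ (S , sh , st) = record
        { headₛ = Split.headₛ S ; tailₛ = subst (λ k → SP v′ w k _) (sym (skip m′)) (Split.tailₛ S)
        ; hlen≡ = trans (cong (_ +_) (skip m)) (trans (Split.hlen≡ S) (sym (+-suc i k))) ; apart = Split.apart S } ,
        sub′ , there ∘ st
        where
        skip : ∀ {z} → z ∈ us → after (u ∷ us) z ≡ after us z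
        skip {z} m rewrite does-≢ {u = u} {z} (λ { refl → u∉ m }) = refl
        sub′ : ∀ {x} → x ∈ Split.hs S → x ∈ hs ⊎ x ∈ u ∷ us
        sub′ x∈ with sh x∈
        ... | inj₁ (here refl) = inj₂ (there y∈)
        ... | inj₁ (there z∈)  = inj₁ z∈
        ... | inj₂ z∈          = inj₂ (there z∈)

    split-pair : ∀ {u i k hs us v v′} → SP u e i hs → SP u w k us →
                 (∀ {x} → x ∈ hs → x ∈ us → x ≡ u) → v ∈ us → v′ ∈ us → v ≢ v′ →
                 SplitIn hs us (i + k) v v′ ⊎ SplitIn hs us (i + k) v′ v
    split-pair acc p dis (here refl) (here refl) v≢ = contradiction refl v≢
    split-pair {u} {v′ = v′} acc p@(step {vs = us} _ u∉ q) dis (here refl) (there m) v≢ with tail-path q m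
    ... | ts , t , sub = inj₁ (record
      { headₛ = acc ; tailₛ = subst (λ k → SP v′ w k ts) (sym skip) t ; hlen≡ = cong (_ +_) (after-head p)
      ; apart = λ x∈ x∈t → u∉ (subst (_∈ us) (dis x∈ (there (sub x∈t))) (sub x∈t)) } , inj₁ , there ∘ sub)
      where
      skip : after (u ∷ us) v′ ≡ after us v′
      skip rewrite does-≢ v≢ = refl
    split-pair acc p@(step _ u∉ q) dis (there m) (here refl) v≢
      with split-pair acc p dis (here refl) (there m) (v≢ ∘ sym)
    ... | inj₁ S = inj₂ S
    ... | inj₂ S = inj₁ S
    split-pair {u} {i} {suc k} {hs} {_ ∷ us} {v} {v′} acc (step a u∉ p) dis (there m) (there m′) v≢
      with split-pair (step (Adj-sym a) (λ y∈ → u∉ (subst (_∈ us) (dis y∈ (there (start∈ p))) (start∈ p))) acc) p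
             (λ { (here e) _ → e ; (there y∈) z∈ → contradiction (subst (_∈ us) (dis y∈ (there z∈)) z∈) u∉ }) m m′ v≢
    ... | inj₁ S = inj₁ (lift-split u∉ (start∈ p) m m′ S)
    ... | inj₂ S = inj₂ (lift-split u∉ (start∈ p) m′ m S)

-- Pairs of vertices with many common neighbours

module Dense {n : ℕ} (G : Graph n) (ℓ d : ℕ) (3≤ℓ : 3 ≤ ℓ)
  (regular : ∀ v → count (adj G v) ≡ d)
  (dense   : 2 * n < suc (2 * ℓ) * d)
  (large   : 2 * (suc ℓ * (suc ℓ * (3 * ℓ))) ≤ d) where

  open Paths G public

  K : ℕ
  K = 3 * ℓ

  R : V → V → Set
  R u v = K ≤ count (common u v)

  R? : ∀ u v → Dec (R u v)
  R? u v = K ≤? count (common u v)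

  R-sym : ∀ {u v} → R u v → R v u
  R-sym {u} {v} r = ≤-trans r (≤-reflexive (count-cong λ w → ∧-comm (adj G u w) (adj G v w)))

  N⋃ : (ℕ → V) → ℕ → V → Bool
  N⋃ x zero    w = false
  N⋃ x (suc m) w = adj G (x m) w ∨ N⋃ x m w

  N⋃-overlap : ∀ x v k → (∀ i → i < k → count (common v (x i)) ≤ K) →
               count (λ w → adj G v w ∧ N⋃ x k w) ≤ k * K
  N⋃-overlap x v zero h = ≤-reflexive (sum-≡0 λ w → pointwise (adj G v w))
    where
    pointwise : ∀ a → ⟦ a ∧ false ⟧ ≡ 0
    pointwise true  = refl
    pointwise false = refl
  N⋃-overlap x v (suc k) h = begin
    count (λ w → adj G v w ∧ N⋃ x (suc k) w)
      ≤⟨ sum-mono (λ w → pointwise (adj G v w) (adj G (x k) w) (N⋃ x k w)) ⟩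
    sum (λ w → ⟦ common v (x k) w ⟧ + ⟦ adj G v w ∧ N⋃ x k w ⟧)
      ≡⟨ ∑-distrib-+ (λ w → ⟦ common v (x k) w ⟧) _ ⟩
    count (common v (x k)) + count (λ w → adj G v w ∧ N⋃ x k w)
      ≤⟨ +-mono-≤ (h k ≤-refl) (N⋃-overlap x v k λ i l → h i (m≤n⇒m≤1+n l)) ⟩
    K + k * K ∎
    where
    open ≤-Reasoning
    pointwise : ∀ a b u → ⟦ a ∧ (b ∨ u) ⟧ ≤ ⟦ a ∧ b ⟧ + ⟦ a ∧ u ⟧
    pointwise true  true  u = s≤s z≤n
    pointwise true  false u = ≤-refl
    pointwise false b     u = z≤n

  -- Each new neighbourhood contributes `d` vertices, of which at most `m * K` lie in the union of
  -- the `m` earlier ones. The accumulated loss is rounded up to `m * (m * K)`.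
  union-bound : ∀ x m → (∀ i j → i < j → j < m → count (common (x j) (x i)) ≤ K) →
                m * d ≤ count (N⋃ x m) + m * (m * K)
  union-bound x zero    h = z≤n
  union-bound x (suc m) h = begin
    d + m * d
      ≤⟨ +-monoʳ-≤ d (union-bound x m λ i j l u → h i j l (m≤n⇒m≤1+n u)) ⟩
    d + (count (N⋃ x m) + m * (m * K))
      ≡⟨ +-assoc d _ _ ⟨
    d + count (N⋃ x m) + m * (m * K)
      ≡⟨ cong (_+ m * (m * K)) (trans (cong (_+ count (N⋃ x m)) (sym (regular (x m)))) (sym (∑-distrib-+ (λ w → ⟦ adj G (x m) w ⟧) _))) ⟩
    sum (λ w → ⟦ adj G (x m) w ⟧ + ⟦ N⋃ x m w ⟧) + m * (m * K)
      ≤⟨ +-monoˡ-≤ _ (≤-trans (sum-mono λ w → pointwise (adj G (x m) w) (N⋃ x m w)) (≤-reflexive (∑-distrib-+ (λ w → ⟦ N⋃ x (suc m) w ⟧) _))) ⟩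
    count (N⋃ x (suc m)) + count (λ w → adj G (x m) w ∧ N⋃ x m w) + m * (m * K)
      ≤⟨ +-monoˡ-≤ _ (+-monoʳ-≤ (count (N⋃ x (suc m))) (N⋃-overlap x (x m) m λ i l → h i m l ≤-refl)) ⟩
    count (N⋃ x (suc m)) + m * K + m * (m * K)
      ≤⟨ ≤-trans (m≤m+n _ (K + m * K)) (≤-reflexive (rearrange (count (N⋃ x (suc m))) m K)) ⟩
    count (N⋃ x (suc m)) + suc m * (suc m * K) ∎
    where
    open ≤-Reasoning
    pointwise : ∀ a u → ⟦ a ⟧ + ⟦ u ⟧ ≤ ⟦ a ∨ u ⟧ + ⟦ a ∧ u ⟧
    pointwise true  u = ≤-refl
    pointwise false u = m≤m+n _ _
    rearrange : ∀ c m k → c + m * k + m * (m * k) + (k + m * k) ≡ c + suc m * (suc m * k)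
    rearrange = solve-∀

  -- ℓ + 1 neighbourhoods of size d > 2n/(2ℓ+1) cannot be almost disjoint.
  R-pair : ∀ (x : ℕ → V) → ∃₂ λ i j → i < j × j ≤ ℓ × R (x i) (x j)
  R-pair x with anyUpTo? (λ j → anyUpTo? (λ i → R? (x i) (x j)) j) (suc ℓ)
  ... | yes (j , s≤s j≤ℓ , i , i<j , r) = i , j , i<j , j≤ℓ , r
  ... | no none = contradiction bound (<⇒≱ strict)
    where
    X = suc ℓ * (suc ℓ * K)
    sparse : ∀ i j → i < j → j < suc ℓ → count (common (x j) (x i)) ≤ K
    sparse i j i<j j≤ℓ with K ≤? count (common (x j) (x i))
    ... | yes r = contradiction (j , j≤ℓ , i , i<j , R-sym r) none
    ... | no ¬r = <⇒≤ (≰⇒> ¬r)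
    bound : 2 * (suc ℓ * d) ≤ 2 * (n + X)
    bound = *-monoʳ-≤ 2 {suc ℓ * d} {n + X} (≤-trans (union-bound x (suc ℓ) sparse) (+-monoˡ-≤ X {count (N⋃ x (suc ℓ))} {n} (count≤n _)))
    rearrange : ∀ l d → suc (2 * l) * d + d ≡ 2 * (suc l * d)
    rearrange = solve-∀
    -- `2(ℓ + 1)d` is `(2ℓ + 1)d`, which exceeds `2n`, plus one more `d`, which by `large` pays for
    -- the overlaps `2X`.
    strict : 2 * (n + X) < 2 * (suc ℓ * d)
    strict = begin-strict
      2 * (n + X)           ≡⟨ *-distribˡ-+ 2 n X ⟩
      2 * n + 2 * X         <⟨ +-mono-<-≤ dense large ⟩
      suc (2 * ℓ) * d + d   ≡⟨ rearrange ℓ d ⟩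
      2 * (suc ℓ * d)       ∎
      where open ≤-Reasoning

  -- The forbidden cycle has `suc m`, that is 2ℓ - 1, vertices.
  m : ℕ
  m = 2 * ℓ ∸ 2

  m+2 : m + 2 ≡ 2 * ℓ
  m+2 = 2ℓ∸2+2 3≤ℓ

  close-fresh : ∀ {g p z} → Path g p → common (p 0) (p g) z ≡ true → z ∉ vertices g p →
                Path (suc g) (z ▸ p) × Adj (p g) z
  close-fresh {g} {p} {z} P cz z∉ =
    prepend P (Adj-sym (proj₁ (∧-true cz))) (fresh-≢ z∉) , proj₂ (∧-true {adj G (p 0) z} cz)

  -- An R-pair a, b of ends is replaced by an R-pair among the common neighbours of a and b.
  short-odd-link : ∀ j g p → Path g p → R (p 0) (p g) → suc g + (j + j) ≡ m → ContainsCycleSuc m G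
  short-odd-link zero g p P r e
    with fresh (common (p 0) (p g)) (vertices g p) (≤-trans small r)
    where
    small : length (vertices g p) < K
    small = begin-strict
      length (vertices g p) ≡⟨ length-applyUpTo p (suc g) ⟩
      suc g                 ≡⟨ trans (sym (+-identityʳ _)) e ⟩
      m                     <⟨ m<m+n m (s≤s z≤n) ⟩
      m + 2                 ≡⟨ m+2 ⟩
      2 * ℓ                 ≤⟨ *-monoˡ-≤ ℓ {2} {3} (s≤s (s≤s z≤n)) ⟩
      K                     ∎
      where open ≤-Reasoning
  ... | z , cz , z∉ = let Q , a = close-fresh P cz z∉ in
    subst (λ k → ContainsCycleSuc k G) (trans (sym (+-identityʳ _)) e) (cycle-of Q a)
  short-odd-link (suc j) g p P r e
    with freshes (common (p 0) (p g)) (p 0) (suc ℓ) (vertices g p) (≤-trans small r)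
    where
    small : length (vertices g p) + suc ℓ ≤ K
    small = begin
      length (vertices g p) + suc ℓ ≡⟨ cong (_+ suc ℓ) (length-applyUpTo p (suc g)) ⟩
      suc g + suc ℓ                 ≤⟨ +-monoˡ-≤ (suc ℓ) {suc g} {m} (≤-trans (m≤m+n (suc g) (suc j + suc j)) (≤-reflexive e)) ⟩
      m + suc ℓ                     ≤⟨ ≤-trans (m≤m+n _ 1) (≤-reflexive (rearrange m ℓ)) ⟩
      m + 2 + ℓ                     ≡⟨ cong (_+ ℓ) m+2 ⟩
      2 * ℓ + ℓ                     ≡⟨ +-comm (2 * ℓ) ℓ ⟩
      K                             ∎
      where
      open ≤-Reasoning
      rearrange : ∀ m l → m + suc l + 1 ≡ m + 2 + l
      rearrange = solve-∀
  ... | x , good , inj with R-pair x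
  ...   | s , t , s<t , t≤ℓ , r′ =
    -- The new path is `x t`, `p g`, ..., `p 0`, `x s`; `j` counts the lengthenings still to come.
    short-odd-link j (suc (suc g)) (x t ▸ q) Q
      (subst (λ k → R (x t) ((x s ▸ p) k)) (sym (n∸n≡0 g)) (R-sym r′))
      (trans (rearrange g j) e)
    where
    xs = good s (≤-trans s<t (≤-trans t≤ℓ (n≤1+n ℓ)))
    xt = good t (s≤s t≤ℓ)
    P′ = prepend {v = x s} P (Adj-sym (proj₁ (∧-true (proj₁ xs)))) (fresh-≢ (proj₂ xs))
    q : ℕ → V
    q i = (x s ▸ p) (suc g ∸ i)
    avoid : ∀ k → k ≤ suc g → x t ≢ (x s ▸ p) k
    avoid zero    _       = inj s t s<t (s≤s t≤ℓ) ∘ sym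
    avoid (suc k) (s≤s l) = fresh-≢ {p = p} (proj₂ xt) k l
    Q : Path (suc (suc g)) (x t ▸ q)
    Q = prepend (reversePath P′) (Adj-sym (proj₂ (∧-true {adj G (p 0) (x t)} (proj₁ xt))))
          (λ i _ → avoid (suc g ∸ i) (m∸n≤m (suc g) i))
    rearrange : ∀ g j → suc (suc (suc g)) + (j + j) ≡ suc g + (suc j + suc j)
    rearrange = solve-∀

  -- The long cycle closed from a shortest odd path between linked vertices.

  module LongCycle (W : ℕ) (c : ℕ → V) (C : Cycle W c) (W-odd : odd W ≡ true) (2ℓ<W : 2 * ℓ < W)
    (no-shorter : ∀ k p → suc (suc k) < W → odd k ≡ true → Path k p → ¬ R (p 0) (p k)) where

    6<W : 6 < W
    6<W = ≤-trans (s≤s (*-monoʳ-≤ 2 3≤ℓ)) 2ℓ<W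

    wrap : ∀ i t u → t + u ≡ W → c (i + t + u) ≡ c i
    wrap i t u e = trans (cong c (trans (+-assoc i t u) (cong (i +_) e))) (periodic C i)

    c+0 : ∀ i → c (i + 0) ≡ c i
    c+0 i = cong c (+-identityʳ i)

    co-odd : ∀ t u → t + u ≡ W → odd t ≡ false → odd u ≡ true
    co-odd t u e f = trans (trans (cong (_xor odd u) (sym f)) (sym (odd-+ t u))) (trans (cong odd e) W-odd)

    near-W : ∀ {t} → t < W → ¬ suc (suc t) < W → odd t ≡ true → suc (suc t) ≡ W
    near-W {t} t<W ¬< o with m≤n⇒m<n∨m≡n t<W
    ... | inj₁ l    = ≤-antisym l (≮⇒≥ ¬<)
    ... | inj₂ refl = contradiction (trans (sym W-odd) (cong not o)) λ ()

    -- One of the two arcs between the vertices is odd. Minimality excludes it unless its length is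
    -- W - 2, and then the other arc has length 2.
    R-gap : ∀ i t → 0 < t → t < W → R (c i) (c (i + t)) → t ≡ 2 ⊎ suc (suc t) ≡ W
    R-gap i t pos t<W r with odd t in o
    ... | true = inj₂ (near-W t<W
      (λ l → no-shorter t _ l o (arc C i t t<W) (subst (λ v → R v (c (i + t))) (sym (c+0 i)) r)) o)
    R-gap i 2 pos t<W r | false = inj₁ refl
    R-gap i t@(suc (suc (suc t′))) pos t<W r | false =
      contradiction (R-sym (subst₂ R (sym (wrap i t u t+u)) (sym (c+0 (i + t))) r))
        (no-shorter u _ u+2<W (co-odd t u t+u o) (arc C (i + t) u u<W))
      where
      u = W ∸ t
      t+u : t + u ≡ W
      t+u = m+[n∸m]≡n (<⇒≤ t<W)
      u+2<W : suc (suc u) < W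
      u+2<W = ≤-trans (+-monoˡ-≤ u (s≤s (s≤s (s≤s z≤n)))) (≤-reflexive t+u)
      u<W : u < W
      u<W = ≤-trans (n≤1+n _) (≤-trans (n≤1+n _) u+2<W)

    -- Only c₀ and c₋₂ can be R-related among the ℓ + 1 vertices c₀, c₄, …, c₄ₗ.
    R-two : ∀ i → R (c i) (c (i + 2))
    -- For W = 2ℓ + 1 the step 4 returns to `b - 2` after ℓ steps, since 4ℓ = 2W - 2. The start
    -- `i + 2` makes this last vertex `c i`.
    R-two i with R-pair (λ s → c (i + 2 + ((s + s) + (s + s))))
    ... | s , s′ , s<s′ , s′≤ℓ , r = conclude (4u <? W)
      where
      b = i + 2
      u = s′ ∸ s
      4u = (u + u) + (u + u)
      a = b + ((s + s) + (s + s))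
      s+u : s + u ≡ s′
      s+u = m+[n∸m]≡n (<⇒≤ s<s′)
      u≤ℓ : u ≤ ℓ
      u≤ℓ = ≤-trans (m∸n≤m s′ s) s′≤ℓ
      shift : ∀ b s u → b + ((s + u + (s + u)) + (s + u + (s + u))) ≡ b + ((s + s) + (s + s)) + ((u + u) + (u + u))
      shift = solve-∀
      r′ : R (c a) (c (a + 4u))
      r′ = subst (λ k → R (c a) (c k)) (trans (cong (λ x → b + ((x + x) + (x + x))) (sym s+u)) (shift b s u)) r
      4u-even : odd 4u ≡ false
      4u-even = odd-double (u + u)
      0<u : 0 < u
      0<u = m<n⇒0<n∸m s<s′
      0<4u : 0 < 4u
      0<4u = ≤-trans 0<u (≤-trans (m≤m+n u u) (m≤m+n _ _))
      2<4u : 2 < 4u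
      2<4u = ≤-trans (s≤s (s≤s (s≤s z≤n))) (+-mono-≤ {2} {u + u} {2} (+-mono-≤ 0<u 0<u) (+-mono-≤ 0<u 0<u))
      conclude : Dec (4u < W) → R (c i) (c (i + 2))
      conclude (yes l) with R-gap a 4u 0<4u l r′
      ... | inj₁ e = contradiction e (>⇒≢ 2<4u)
      ... | inj₂ e = contradiction (trans (sym W-odd) (trans (cong odd (sym e)) (cong (not ∘ not) 4u-even))) λ ()
      -- After one full turn the remaining gap `v` is odd, hence W - 2. So 4u + 2 = 2W, and W ≥ 2ℓ +
      -- 1 with u ≤ ℓ forces u = ℓ and s = 0.
      conclude (no ¬l) = finish (R-gap a v 0<v v<W r″)
        where
        v = 4u ∸ W
        W≤4u : W ≤ 4u
        W≤4u = ≮⇒≥ ¬l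
        v+W : v + W ≡ 4u
        v+W = m∸n+n≡m W≤4u
        v-odd : odd v ≡ true
        v-odd with odd v | odd-+ v W
        ... | true  | _ = refl
        ... | false | q = contradiction (trans (sym (trans q W-odd)) (trans (cong odd v+W) 4u-even)) λ ()
        0<v : 0 < v
        0<v = n≢0⇒n>0 (λ z → contradiction (trans (sym v-odd) (cong odd z)) λ ())
        double : ∀ l → (l + l) + (l + l) ≡ 2 * l + 2 * l
        double = solve-∀
        4u≤ : 4u ≤ 2 * ℓ + 2 * ℓ
        4u≤ = ≤-trans (+-mono-≤ (+-mono-≤ u≤ℓ u≤ℓ) (+-mono-≤ u≤ℓ u≤ℓ)) (≤-reflexive (double ℓ))
        v<W : v < W
        v<W = +-cancelʳ-< W v W (≤-trans (s≤s (≤-trans (≤-reflexive v+W) 4u≤)) (+-mono-< 2ℓ<W 2ℓ<W))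
        r″ : R (c a) (c (a + v))
        r″ = subst (λ x → R (c a) x)
               (trans (cong c (trans (cong (a +_) (sym v+W)) (sym (+-assoc a v W)))) (periodic C (a + v))) r′
        finish : v ≡ 2 ⊎ suc (suc v) ≡ W → R (c i) (c (i + 2))
        finish (inj₁ e) = contradiction (trans (sym v-odd) (cong odd e)) λ ()
        finish (inj₂ e) = R-sym (subst₂ R (cong c a≡b) (trans (cong (λ x → c (x + v)) a≡b) (wrap i 2 v e)) r″)
          where
          ℓ≤u : ℓ ≤ u
          ℓ≤u = *-cancelˡ-≤ 4 (+-cancelʳ-≤ 2 (4 * ℓ) (4 * u) (begin
            4 * ℓ + 2           ≡⟨ rearrange₁ ℓ ⟩
            suc (2 * ℓ) + suc (2 * ℓ) ≤⟨ +-mono-≤ 2ℓ<W 2ℓ<W ⟩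
            W + W               ≡⟨ cong (_+ W) e ⟨
            2 + v + W           ≡⟨ cong (2 +_) v+W ⟩
            2 + 4u              ≡⟨ rearrange₂ u ⟩
            4 * u + 2           ∎))
            where
            open ≤-Reasoning
            rearrange₁ : ∀ l → 4 * l + 2 ≡ suc (2 * l) + suc (2 * l)
            rearrange₁ = solve-∀
            rearrange₂ : ∀ u → 2 + ((u + u) + (u + u)) ≡ 4 * u + 2
            rearrange₂ = solve-∀
          s≡0 : s ≡ 0
          s≡0 = n≤0⇒n≡0 (+-cancelʳ-≤ u s 0 (≤-trans (≤-reflexive s+u) (≤-trans s′≤ℓ ℓ≤u)))
          a≡b : a ≡ b
          a≡b = trans (cong (λ x → b + ((x + x) + (x + x))) s≡0) (+-identityʳ b)

    -- Otherwise the chord, followed by the arc from `c i` to the vertex two before the other end of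
    -- the chord, is a forbidden odd path: its ends are linked by `R-two`.
    chord-even : ∀ i t → 0 < t → t < W → odd t ≡ false → Adj (c i) (c (i + t)) → suc t ≡ W
    chord-even i (suc (suc t)) pos t<W o a with m≤n⇒m<n∨m≡n t<W
    ... | inj₂ e = e
    ... | inj₁ l = contradiction
      (R-sym (subst (λ x → R (c (i + t)) (c x)) (trans (+-assoc i t 2) (cong (i +_) (+-comm t 2))) (R-two (i + t))))
      (no-shorter (suc t) (c (i + suc (suc t)) ▸ λ s → c (i + s)) l (trans (cong not (sym (not-involutive (odd t)))) (cong not o))
        (prepend (arc C i t (≤-trans (n≤1+n _) (≤-trans (n≤1+n _) t<W)))
          (Adj-sym (subst (λ v → Adj v (c (i + suc (suc t)))) (sym (c+0 i)) a))
          (λ s s≤t e → distinct (arc C i (suc (suc t)) t<W) s (suc (suc t)) (≤-trans (s≤s s≤t) (n≤1+n _)) ≤-refl (sym e))))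

    chord : ∀ i t → 0 < t → t < W → Adj (c i) (c (i + t)) → t ≡ 1 ⊎ suc t ≡ W
    chord i t pos t<W a with odd t in o
    ... | false = inj₂ (chord-even i t pos t<W o a)
    ... | true  = inj₁ (+-cancelʳ-≡ u t 1 (trans t+u (sym 1+u)))
      where
      u = W ∸ t
      t+u : t + u ≡ W
      t+u = m+[n∸m]≡n (<⇒≤ t<W)
      u-even : odd u ≡ false
      u-even with odd u | odd-+ t u
      ... | false | _ = refl
      ... | true  | q = contradiction (trans (sym (trans q (cong (_xor true) o))) (trans (cong odd t+u) W-odd)) λ ()
      1+u : suc u ≡ W
      1+u = chord-even (i + t) u (m<n⇒0<n∸m t<W) (≤-trans (+-monoˡ-≤ u pos) (≤-reflexive t+u)) u-even
              (subst (Adj (c (i + t))) (sym (wrap i t u t+u)) (Adj-sym a))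

    -- A detour through `w` gives an odd path whose ends are linked by `R-two`: for t ≥ 3 the path
    -- `c (i + t)`, `w`, `c i`, ..., `c (i + t - 2)` of length t, and for t = 1 the path `c i`, `w`,
    -- `c (i + 1)`, `c (i + 2)`.
    outside-gap-odd : ∀ w i t → t < W → odd t ≡ true → (∀ s → s < W → w ≢ c (i + s)) →
                      Adj w (c i) → Adj w (c (i + t)) → suc (suc t) ≡ W
    outside-gap-odd w i 1 t<W o off a b = contradiction
      (R-two i)
      (no-shorter 3 (c i ▸ w ▸ λ s → c (i + 1 + s)) (≤-trans (n≤1+n _) 6<W) refl
        (prepend (prepend (arc C (i + 1) 1 t<W) (subst (Adj w) (sym (c+0 (i + 1))) b)
           (λ s s≤1 → subst (λ k → w ≢ c k) (sym (+-assoc i 1 s)) (off (1 + s) (≤-trans (s≤s (s≤s s≤1)) (≤-trans (m≤m+n 3 4) 6<W)))))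
          (Adj-sym a) new)
        ∘ subst (λ k → R (c i) (c k)) (sym (+-assoc i 1 1)))
      where
      new : ∀ s → s ≤ 2 → c i ≢ (w ▸ λ s → c (i + 1 + s)) s
      new zero    _       e = off 0 (≤-trans (m≤m+n 1 6) 6<W) (trans (sym e) (sym (c+0 i)))
      new (suc s) (s≤s l) e = cdist C i (suc s) (s≤s z≤n) (≤-trans (s≤s (s≤s l)) (≤-trans (m≤m+n 3 4) 6<W)) (trans e (cong c (+-assoc i 1 s)))
    outside-gap-odd w i t@(suc (suc t′)) t<W o off a b = near-W t<W
      (λ l → no-shorter t (c (i + t) ▸ w ▸ λ s → c (i + s)) l o
        (prepend (prepend (arc C i t′ t′<W) (subst (Adj w) (sym (c+0 i)) a)
            (λ s s≤ → off s (≤-trans (s≤s s≤) t′<W)))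
          (Adj-sym b) new)
        (R-sym (subst (λ x → R (c (i + t′)) (c x)) (trans (+-assoc i t′ 2) (cong (i +_) (+-comm t′ 2))) (R-two (i + t′)))))
      o
      where
      t′<W : t′ < W
      t′<W = ≤-trans (n≤1+n _) (≤-trans (n≤1+n _) t<W)
      new : ∀ s → s ≤ suc t′ → c (i + t) ≢ (w ▸ λ s → c (i + s)) s
      new zero    _       e = off t t<W (sym e)
      new (suc s) (s≤s l) e = distinct (arc C i t t<W) s t (≤-trans (s≤s l) (n≤1+n _)) ≤-refl (sym e)

    outside-gap : ∀ w i t → 0 < t → t < W → (∀ s → s < W → w ≢ c (i + s)) →
                  Adj w (c i) → Adj w (c (i + t)) → t ≡ 2 ⊎ suc (suc t) ≡ W
    outside-gap w i t pos t<W off a b with odd t in o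
    ... | true  = inj₂ (outside-gap-odd w i t t<W o off a b)
    ... | false = inj₁ (+-cancelʳ-≡ u t 2 (trans t+u (sym 2+u)))
      where
      u = W ∸ t
      t+u : t + u ≡ W
      t+u = m+[n∸m]≡n (<⇒≤ t<W)
      off′ : ∀ s → s < W → w ≢ c (i + t + s)
      off′ s s<W e with t + s <? W
      ... | yes l = off (t + s) l (trans e (cong c (+-assoc i t s)))
      ... | no ¬l = off x x<W (trans e (trans (cong c (trans (+-assoc i t s) (trans (cong (i +_) (sym x+W)) (sym (+-assoc i x W))))) (periodic C (i + x))))
        where
        x = t + s ∸ W
        x+W : x + W ≡ t + s
        x+W = m∸n+n≡m (≮⇒≥ ¬l)
        x<W : x < W
        x<W = +-cancelʳ-< W x W (≤-trans (s≤s (≤-reflexive x+W)) (≤-trans (+-monoʳ-< t s<W) (+-monoˡ-≤ W (<⇒≤ t<W))))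
      2+u : suc (suc u) ≡ W
      2+u = outside-gap-odd w (i + t) u (≤-trans (+-monoˡ-≤ u pos) (≤-reflexive t+u)) (co-odd t u t+u o) off′ b
              (subst (Adj w) (sym (wrap i t u t+u)) a)

    -- For `w` on the cycle, `chord` leaves only its two cycle neighbours, which are at distance 2
    -- around `w`.
    gap : ∀ w i t → 0 < t → t < W → Adj w (c i) → Adj w (c (i + t)) → t ≡ 2 ⊎ suc (suc t) ≡ W
    gap w i t pos t<W a b with anyUpTo? (λ s → w Fin.≟ c (i + s)) W
    ... | no none = outside-gap w i t pos t<W (λ s l e → none (s , l , e)) a b
    ... | yes (zero , _ , refl) = contradiction (subst (Adj _) (sym (c+0 i)) a) Adj-irrefl
    ... | yes (x@(suc _) , x<W , refl) with chord i x (s≤s z≤n) x<W (Adj-sym a) | <-cmp t x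
    ...   | _ | tri≈ _ refl _ = contradiction b Adj-irrefl
    ...   | inj₁ refl | tri< t<1 _ _ = contradiction (≤-trans t<1 pos) (<-irrefl refl)
    ...   | inj₂ refl | tri> _ _ x<t = contradiction (≤-trans t<W x<t) (<-irrefl refl)
    ...   | inj₁ refl | tri> _ _ 1<t with chord (i + 1) (t ∸ 1) (m<n⇒0<n∸m 1<t) (≤-trans (s≤s (m∸n≤m t 1)) t<W)
                                         (subst (λ k → Adj (c (i + 1)) (c k)) (trans (cong (i +_) (sym (m+[n∸m]≡n (<⇒≤ 1<t)))) (sym (+-assoc i 1 _))) b)
    ...     | inj₁ e = inj₁ (trans (sym (m+[n∸m]≡n (<⇒≤ 1<t))) (cong suc e))
    ...     | inj₂ e = contradiction (trans (sym (m+[n∸m]≡n (<⇒≤ 1<t))) e) (<⇒≢ t<W)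
    gap w i t pos t<W a b | yes (x@(suc _) , x<W , refl) | inj₂ refl | tri< t<x _ _
      with chord (i + t) (x ∸ t) (m<n⇒0<n∸m t<x) (≤-trans (s≤s (m∸n≤m x t)) x<W)
             (Adj-sym (subst (λ k → Adj (c k) (c (i + t))) (trans (cong (i +_) (sym (m+[n∸m]≡n (<⇒≤ t<x)))) (sym (+-assoc i t _))) b))
    ...     | inj₁ e = inj₂ (cong suc (trans (sym (trans (cong (t +_) e) (+-comm t 1))) (m+[n∸m]≡n (<⇒≤ t<x))))
    ...     | inj₂ e = contradiction (suc-injective e) (<⇒≢ (∸-monoʳ-< pos (<⇒≤ t<x)))

    -- Three neighbours give gaps `a`, `b` and `a + b`, each 2 or W - 2. If `a` or `b` is W - 2,
    -- then `a + b` reaches W; if both are 2, then 4 is W - 2, although W is odd.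
    at-most-two : ∀ w → count {W} (λ i → adj G (c (toℕ i)) w) ≤ 2
    at-most-two w with count {W} (λ i → adj G (c (toℕ i)) w) ≤? 2
    ... | yes l = l
    ... | no ¬l with pick₃ {W} (λ i → adj G (c (toℕ i)) w) (≰⇒> ¬l)
    ...   | i , j , k , i<j , j<k , p , q , r =
      ⊥-elim (impossible (gap w (toℕ i) a 0<a a<W (Adj-sym p) Aj)
                         (gap w (toℕ j) b 0<b b<W (Adj-sym q) (subst (Adj w) (cong c (sym j+b)) (Adj-sym r)))
                         (gap w (toℕ i) (a + b) (≤-trans 0<a (m≤m+n a b)) a+b<W (Adj-sym p)
                           (subst (Adj w) (cong c (sym i+ab)) (Adj-sym r))))
      where
      a = toℕ j ∸ toℕ i
      b = toℕ k ∸ toℕ j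
      0<a = m<n⇒0<n∸m i<j
      0<b = m<n⇒0<n∸m j<k
      i+a : toℕ i + a ≡ toℕ j
      i+a = m+[n∸m]≡n (<⇒≤ i<j)
      j+b : toℕ j + b ≡ toℕ k
      j+b = m+[n∸m]≡n (<⇒≤ j<k)
      i+ab : toℕ i + (a + b) ≡ toℕ k
      i+ab = trans (sym (+-assoc (toℕ i) a b)) (trans (cong (_+ b) i+a) j+b)
      a+b<W : a + b < W
      a+b<W = ≤-trans (s≤s (≤-trans (m≤n+m (a + b) (toℕ i)) (≤-reflexive i+ab))) (Fin.toℕ<n k)
      a<W = ≤-trans (s≤s (m≤m+n a b)) a+b<W
      b<W = ≤-trans (s≤s (m≤n+m b a)) a+b<W
      Aj : Adj w (c (toℕ i + a))
      Aj = subst (Adj w) (cong c (sym i+a)) (Adj-sym q)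
      far : suc (suc a) ≡ W → 2 ≤ b → ⊥
      far e 2≤b = <-irrefl refl (≤-trans a+b<W (≤-trans (≤-reflexive (trans (sym e) (+-comm 2 a))) (+-monoʳ-≤ a 2≤b)))
      far′ : suc (suc b) ≡ W → 2 ≤ a → ⊥
      far′ e 2≤a = <-irrefl refl (≤-trans a+b<W (≤-trans (≤-reflexive (sym e)) (+-monoˡ-≤ b 2≤a)))
      big : ∀ {x} → suc (suc x) ≡ W → 2 ≤ x
      big e = s≤s⁻¹ (s≤s⁻¹ (≤-trans (m≤m+n 4 3) (≤-trans 6<W (≤-reflexive (sym e)))))
      impossible : a ≡ 2 ⊎ suc (suc a) ≡ W → b ≡ 2 ⊎ suc (suc b) ≡ W → a + b ≡ 2 ⊎ suc (suc (a + b)) ≡ W → ⊥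
      impossible (inj₂ e) (inj₁ f) _ = far e (≤-reflexive (sym f))
      impossible (inj₂ e) (inj₂ f) _ = far e (big f)
      impossible (inj₁ e) (inj₂ f) _ = far′ f (≤-reflexive (sym e))
      impossible (inj₁ e) (inj₁ f) (inj₁ g) with trans (sym g) (cong₂ _+_ e f)
      ... | ()
      impossible (inj₁ e) (inj₁ f) (inj₂ g) =
        contradiction (trans (sym W-odd) (cong odd (trans (sym g) (cong (2 +_) (cong₂ _+_ e f))))) λ ()

    absurd : ⊥
    absurd = <-irrefl refl (begin-strict
      2 * n                                                <⟨ dense ⟩
      suc (2 * ℓ) * d                                      ≤⟨ *-monoˡ-≤ d 2ℓ<W ⟩
      W * d                                                ≡⟨ sum-const W d ⟨
      sum {W} (λ _ → d)                                    ≡⟨ sum-cong-≗ {W} (λ i → sym (regular (c (toℕ i)))) ⟩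
      sum {W} (λ i → count (adj G (c (toℕ i))))            ≡⟨ ∑-comm {W} (λ i w → ⟦ adj G (c (toℕ i)) w ⟧) ⟩
      sum (λ w → count {W} (λ i → adj G (c (toℕ i)) w))    ≤⟨ sum-mono at-most-two ⟩
      sum {n} (λ _ → 2)                                    ≡⟨ trans (sum-const n 2) (*-comm n 2) ⟩
      2 * n                                                ∎)
      where open ≤-Reasoning

  -- No odd path joins linked vertices.

  no-odd-link : ¬ ContainsCycleSuc m G → ∀ g p → odd g ≡ true → Path g p → ¬ R (p 0) (p g)
  no-odd-link free = <-rec _ λ g rec p o P r → main g (λ k q l → rec {k} l q) p o P r
    where
    NoLink : ℕ → Set
    NoLink g = ∀ p → odd g ≡ true → Path g p → ¬ R (p 0) (p g)

    m-even : odd m ≡ false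
    m-even = trans (sym (not-involutive (odd m))) (trans (cong odd (trans (+-comm 2 m) m+2)) (odd-2* ℓ))

    -- The chord bypasses `i` edges, an odd number and more than one. Using it shortens the path by
    -- a positive even number and keeps both ends.
    shortcut : ∀ g → (∀ k p → k < g → odd k ≡ true → Path k p → ¬ R (p 0) (p k)) →
               ∀ p → odd g ≡ true → Path g p → R (p 0) (p g) →
               ∀ i → 1 < i → i ≤ g → odd i ≡ true → Adj (p 0) (p i) → ⊥
    shortcut g rec p o P r i 1<i i≤g oi a = rec (suc k) (p 0 ▸ λ t → p (i + t)) k<g k-odd
      (prepend (suffix i k P (≤-reflexive i+k)) (subst (λ x → Adj (p 0) (p x)) (sym (+-identityʳ i)) a)
        λ t t≤k → distinct P 0 (i + t) (≤-trans (≤-trans (n≤1+n 1) 1<i) (m≤m+n i t)) (≤-trans (+-monoʳ-≤ i t≤k) (≤-reflexive i+k)))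
      (subst (λ x → R (p 0) (p x)) (sym i+k) r)
      where
      k = g ∸ i
      i+k : i + k ≡ g
      i+k = m+[n∸m]≡n i≤g
      k<g : suc k < g
      k<g = ≤-trans (+-monoˡ-≤ k 1<i) (≤-reflexive i+k)
      k-odd : odd (suc k) ≡ true
      k-odd with odd k | odd-+ i k
      ... | false | _ = refl
      ... | true  | q = contradiction (trans (sym o) (trans (cong odd (sym i+k)) (trans q (cong (_xor true) oi)))) λ ()

    main : ∀ g → (∀ k p → k < g → odd k ≡ true → Path k p → ¬ R (p 0) (p k)) → NoLink g
    main g rec p o P r with suc g ≤? m
    ... | yes l = free (short-odd-link j g p P r (trans (cong (suc g +_) (sym 2j)) (m+[n∸m]≡n l)))
      where
      even-rest : odd (m ∸ suc g) ≡ false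
      even-rest with odd (m ∸ suc g) | odd-+ (suc g) (m ∸ suc g)
      ... | false | _ = refl
      ... | true  | q = contradiction (trans (sym m-even) (trans (cong odd (sym (m+[n∸m]≡n l))) (trans q (cong (λ x → not x xor true) o)))) λ ()
      j = proj₁ (half (m ∸ suc g) even-rest)
      2j = proj₂ (half (m ∸ suc g) even-rest)
    -- Avoiding `p 1` and `p (g - 1)` makes `z`, if it lies on the path, the end of a proper chord
    -- from `p 0` and of one from `p g`. As `g` is odd, one of the two bypasses an odd number of
    -- edges.
    ... | no ¬l with fresh (common (p 0) (p g)) (p 1 ∷ p (g ∸ 1) ∷ []) (≤-trans (≤-trans 3≤ℓ (m≤m+n ℓ _)) r)
    ...   | z , cz , z∉ with anyUpTo? (λ i → z Fin.≟ p i) (suc g)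
    ...     | no none = LongCycle.absurd (suc (suc g)) _ (closePath Q a) W-odd 2ℓ<W
                         (λ k q l → rec k q (s≤s⁻¹ (s≤s⁻¹ l)))
      where
      QA = close-fresh P cz (λ z∈ → let i , l , e = ∈-applyUpTo⁻ p z∈ in none (i , l , e))
      Q = proj₁ QA
      a = proj₂ QA
      W-odd : odd (suc (suc g)) ≡ true
      W-odd = trans (not-involutive (odd g)) o
      2ℓ<W : 2 * ℓ < suc (suc g)
      2ℓ<W = ≤∧≢⇒< (≤-trans (≤-reflexive (trans (sym m+2) (+-comm m 2))) (s≤s (≰⇒> ¬l)))
               (λ e → contradiction (trans (sym (odd-2* ℓ)) (trans (cong odd e) W-odd)) λ ())
    ...     | yes (i , s≤s i≤g , refl) with odd i in oi
    ...       | true  = shortcut g rec p o P r i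
                 (≤∧≢⇒< (n≢0⇒n>0 λ { refl → contradiction oi λ () }) λ { refl → z∉ (here refl) }) i≤g oi (proj₁ (∧-true cz))
    ...       | false = shortcut g rec (λ t → p (g ∸ t)) o (reversePath P)
                 (R-sym (subst (λ x → R (p x) (p g)) (sym (n∸n≡0 g)) r)) (g ∸ i)
                 (≤∧≢⇒< (n≢0⇒n>0 g∸i≢0) g∸i≢1) (m∸n≤m g i) co-odd
                 (subst (λ x → Adj (p g) (p x)) (sym (m∸[m∸n]≡n i≤g)) (proj₂ (∧-true {adj G (p 0) (p i)} cz)))
      where
      co-odd : odd (g ∸ i) ≡ true
      co-odd = trans (trans (cong (_xor odd (g ∸ i)) (sym oi)) (sym (odd-+ i (g ∸ i)))) (trans (cong odd (m+[n∸m]≡n i≤g)) o)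
      g∸i≢0 : g ∸ i ≢ 0
      g∸i≢0 e = contradiction (trans (sym co-odd) (cong odd e)) λ ()
      g∸i≢1 : 1 ≢ g ∸ i
      g∸i≢1 e = z∉ (there (here (cong p (trans (sym (m∸[m∸n]≡n i≤g)) (cong (g ∸_) (sym e))))))

-- Two-colouring a regular graph

module Subsets {n : ℕ} (G : Graph n) where

  open Paths G using (V; Adj)

  VSet : Set
  VSet = V → Bool

  infix 4 _∋_
  _∋_ : VSet → V → Set
  S ∋ v = S v ≡ true

  degIn : VSet → V → ℕ
  degIn U v = count (λ w → U w ∧ adj G v w)

  Proper : VSet → (V → Bool) → Set
  Proper U χ = ∀ {u v} → U ∋ u → U ∋ v → Adj u v → χ u ≢ χ v

  -- Every edge inside `U` has exactly one end of each colour, so both sides count these edges.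
  double-count : ∀ U χ → Proper U χ →
    sum (λ v → ⟦ U v ∧ χ v ⟧ * degIn U v) ≡ sum (λ v → ⟦ U v ∧ not (χ v) ⟧ * degIn U v)
  double-count U χ proper = begin
    sum (λ v → ⟦ U v ∧ χ v ⟧ * degIn U v)
      ≡⟨ sum-cong-≗ (λ v → sym (sum-*ˡ ⟦ U v ∧ χ v ⟧ (λ w → ⟦ U w ∧ adj G v w ⟧))) ⟩
    sum (λ v → sum (λ w → ⟦ U v ∧ χ v ⟧ * ⟦ U w ∧ adj G v w ⟧))
      ≡⟨ ∑-comm (λ v w → ⟦ U v ∧ χ v ⟧ * ⟦ U w ∧ adj G v w ⟧) ⟩
    sum (λ w → sum (λ v → ⟦ U v ∧ χ v ⟧ * ⟦ U w ∧ adj G v w ⟧))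
      ≡⟨ sum-cong-≗ (λ w → sum-cong-≗ (λ v → swap v w)) ⟩
    sum (λ w → sum (λ v → ⟦ U w ∧ not (χ w) ⟧ * ⟦ U v ∧ adj G w v ⟧))
      ≡⟨ sum-cong-≗ (λ w → sum-*ˡ ⟦ U w ∧ not (χ w) ⟧ (λ v → ⟦ U v ∧ adj G w v ⟧)) ⟩
    sum (λ w → ⟦ U w ∧ not (χ w) ⟧ * degIn U w) ∎
    where
    open ≡-Reasoning
    swap : ∀ v w → ⟦ U v ∧ χ v ⟧ * ⟦ U w ∧ adj G v w ⟧ ≡ ⟦ U w ∧ not (χ w) ⟧ * ⟦ U v ∧ adj G w v ⟧
    swap v w rewrite symmetric G w v with U v in Uv | U w in Uw | adj G v w in a
    ... | false | false | _     = refl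
    ... | false | true  | _     = sym (*-zeroʳ ⟦ not (χ w) ⟧)
    ... | true  | false | _     = *-zeroʳ ⟦ χ v ⟧
    ... | true  | true  | false = trans (*-zeroʳ ⟦ χ v ⟧) (sym (*-zeroʳ ⟦ not (χ w) ⟧))
    ... | true  | true  | true  = cong (λ z → ⟦ z ⟧ * 1) (¬-not (proper Uv Uw a))

-- Fans, blocks and ears.

module Colouring {n : ℕ} (G : Graph n) (d : ℕ) (regular : ∀ v → count (adj G v) ≡ d)
  (R : Fin n → Fin n → Set) (R-sym : ∀ {u v} → R u v → R v u)
  (no-odd : ∀ {s t k vs} → R s t → SimplePaths.SP G s t k vs → odd k ≡ true → ⊥)
  (R-nbrs : ∀ v → ∃₂ λ x y → adj G v x ≡ true × adj G v y ≡ true × x ≢ y × R x y) where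

  open Paths G using (V; Adj; Adj-sym; Adj-irrefl; Adj⇒≢)
  open SimplePaths G
  open Subsets G
  open DecMembership (Fin._≟_ {n}) using (_∈?_)

  Adj? : ∀ u v → Dec (Adj u v)
  Adj? u v = adj G u v ≟ᵇ true

  _∋?_ : ∀ (S : VSet) v → Dec (S ∋ v)
  S ∋? v = S v ≟ᵇ true

  -- A fan fixes parities: any path from `a` to `b` that otherwise avoids the fan completes it to a
  -- path from `s` to `t`, which cannot be odd, so that path is odd exactly when `π` is `true`.
  record Fan (S : V → Set) (a b : V) (π : Bool) : Set where
    constructor fan
    field
      {s t}   : V
      {i j}   : ℕ
      {ps qs} : List V
      link    : R s t
      left    : SP a s i ps
      right   : SP b t j qs
      apart   : Disjoint ps qs
      ps⊆     : ∀ {v} → v ∈ ps → S v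
      qs⊆     : ∀ {v} → v ∈ qs → S v
      oddness : odd (i + j) ≡ π
  open Fan

  fan-sym : ∀ {S a b π} → Fan S a b π → Fan S b a π
  fan-sym F = fan (R-sym (link F)) (right F) (left F) (λ x y → apart F y x) (qs⊆ F) (ps⊆ F)
                  (trans (cong odd (+-comm (j F) (i F))) (oddness F))

  fan-map : ∀ {S S′ a b π π′} → (∀ {v} → S v → S′ v) → π ≡ π′ → Fan S a b π → Fan S′ a b π′
  fan-map f e F = fan (link F) (left F) (right F) (apart F) (f ∘ ps⊆ F) (f ∘ qs⊆ F) (trans (oddness F) e)

  fan-extend : ∀ {S a b π x e h hs} → Fan S a b π → SP x e h hs → Adj e a → (∀ {v} → v ∈ hs → ¬ S v) →
               Fan (λ v → S v ⊎ v ∈ hs) x b (not (odd h) xor π)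
  fan-extend {S} {π = π} {h = h} {hs} F p e~a out = fan (link F)
    (append p e~a (left F) (λ m m′ → out m (ps⊆ F m′))) (right F) dis sub (inj₁ ∘ qs⊆ F) par
    where
    dis : Disjoint (hs ++ ps F) (qs F)
    dis m m′ with ∈-++⁻ hs m
    ... | inj₁ y = out y (qs⊆ F m′)
    ... | inj₂ y = apart F y m′
    sub : ∀ {v} → v ∈ hs ++ ps F → S v ⊎ v ∈ hs
    sub m with ∈-++⁻ hs m
    ... | inj₁ y = inj₂ y
    ... | inj₂ y = inj₁ (ps⊆ F y)
    shift : ∀ h i j → h + suc i + j ≡ suc h + (i + j)
    shift = solve-∀
    par : odd (h + suc (i F) + j F) ≡ not (odd h) xor π
    par = trans (cong odd (shift h (i F) (j F))) (trans (odd-+ (suc h) (i F + j F)) (cong (not (odd h) xor_) (oddness F)))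

  fan-edge : ∀ {S a b π} → Fan S a b π → Adj a b → π ≡ true
  fan-edge {π = true}  F a~b = refl
  fan-edge {π = false} F a~b with append-reversed (left F) a~b (right F) (apart F)
  ... | vs , p = ⊥-elim (no-odd (link F) p (trans (cong odd (+-suc (i F) (j F))) (cong not (oddness F))))

  -- Prolonging one leg by the ear leaves `a` and `e` as the adjacent roots of a fan, where
  -- `fan-edge` applies.
  fan-ear : ∀ {S a b π e e′ k es} → Fan S a b π → Adj a e → SP e e′ k es → Adj e′ b →
            (∀ {v} → v ∈ es → ¬ S v) → odd k ≡ π
  fan-ear F a~e p e′~b out = xor-cancel (fan-edge (fan-extend (fan-sym F) p e′~b out) (Adj-sym a~e))
    where
    xor-cancel : ∀ {x y} → not x xor y ≡ true → x ≡ y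
    xor-cancel {true}  {true}  _ = refl
    xor-cancel {false} {false} _ = refl

  -- This stands in for 2-connectedness. The linked pair may vary with `a` and `b`, and that the
  -- colouring is proper follows in `block-proper`.
  Block : VSet → (V → Bool) → Set
  Block H χ = ∀ {a b} → H ∋ a → H ∋ b → a ≢ b → Fan (H ∋_) a b (χ a xor χ b)

  block-proper : ∀ {H χ} → Block H χ → ∀ {u v} → H ∋ u → H ∋ v → Adj u v → χ u ≢ χ v
  block-proper {χ = χ} B {u} {v} Hu Hv u~v e =
    contradiction (trans (sym (fan-edge (B Hu Hv (Adj⇒≢ u~v)) u~v)) (trans (cong (χ u xor_) (sym e)) (xor-same (χ u)))) λ ()

  -- The legs have length 0, so the two linked vertices receive the same colour.
  edge-block : ∀ {x y} → x ≢ y → R x y → Block (λ v → does (v Fin.≟ x) ∨ does (v Fin.≟ y)) (λ _ → false)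
  edge-block {x} {y} x≢y r {a} {b} Ha Hb a≢b with ∨-true Ha | ∨-true Hb
  ... | inj₁ p | inj₁ q = contradiction (trans (does-≡ p) (sym (does-≡ q))) a≢b
  ... | inj₂ p | inj₂ q = contradiction (trans (does-≡ p) (sym (does-≡ q))) a≢b
  ... | inj₁ p | inj₂ q = fan (subst₂ R (sym (does-≡ p)) (sym (does-≡ q)) r) stop stop
    (λ { (here refl) (here e) → a≢b e }) (λ { (here refl) → Ha }) (λ { (here refl) → Hb }) refl
  ... | inj₂ p | inj₁ q = fan (R-sym (subst₂ R (sym (does-≡ q)) (sym (does-≡ p)) r)) stop stop
    (λ { (here refl) (here e) → a≢b e }) (λ { (here refl) → Ha }) (λ { (here refl) → Hb }) refl

  module AddEar {H : VSet} {χ : V → Bool} (B : Block H χ) {a b e e′ : V} {k : ℕ} {es : List V}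
    (Ha : H ∋ a) (Hb : H ∋ b) (a≢b : a ≢ b) (a~e : Adj a e) (ear : SP e e′ k es) (e′~b : Adj e′ b)
    (out : ∀ {v} → v ∈ es → ¬ H ∋ v) where

    H⁺ : VSet
    H⁺ v = H v ∨ does (v ∈? es)

    -- A vertex of the ear is coloured from `b`: along the ear its distance to `b` is
    -- `after es v + 1`.
    χ⁺ : V → Bool
    χ⁺ v = if does (v ∈? es) then χ b xor not (odd (after es v)) else χ v

    private
      ear-parity : odd k ≡ χ a xor χ b
      ear-parity = fan-ear (B Ha Hb a≢b) a~e ear e′~b out

      χ-in : ∀ {v} → v ∈ es → χ⁺ v ≡ χ b xor not (odd (after es v))
      χ-in {v} m with v ∈? es
      ... | yes _ = refl
      ... | no ¬m = contradiction m ¬m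

      χ-out : ∀ {v} → v ∉ es → χ⁺ v ≡ χ v
      χ-out {v} ¬m with v ∈? es
      ... | yes m = contradiction m ¬m
      ... | no _  = refl

      old : ∀ {v} → H ∋ v → H⁺ ∋ v
      old = true-∨ˡ

      new : ∀ {v} → v ∈ es → H⁺ ∋ v
      new {v} m with v ∈? es
      ... | yes _ = true-∨ʳ (H v) refl
      ... | no ¬m = contradiction m ¬m

      only-start : ∀ {x} → x ∈ e ∷ [] → x ∈ es → x ≡ e
      only-start (here p) _ = p

      in-ear : ∀ {x} → x ∈ e ∷ [] ⊎ x ∈ es → x ∈ es
      in-ear (inj₁ (here refl)) = start∈ ear
      in-ear (inj₂ m)           = m

      xor-move : ∀ {h f c} → h xor f ≡ c → h ≡ c xor f
      xor-move {true}  {true}  refl = refl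
      xor-move {true}  {false} refl = refl
      xor-move {false} {true}  refl = refl
      xor-move {false} {false} refl = refl

      head-parity : ∀ {h v} → h + after es v ≡ k → odd h ≡ (χ a xor χ b) xor odd (after es v)
      head-parity {h} {v} e = xor-move (trans (sym (odd-+ h (after es v))) (trans (cong odd e) ear-parity))

      open xor-∧-Solver

      old-new : ∀ {x y} → x ∈ es → H ∋ y → Fan (H⁺ ∋_) x y (χ⁺ x xor χ⁺ y)
      -- The ear vertex `x` walks back to `a` and continues in the fan of `a` and `y`. If `y` is `a`
      -- itself, it leaves through `b` instead.
      old-new {x} {y} m Hy with y Fin.≟ a
      ... | no y≢a with head-path stop ear only-start m
      ...   | h , hs , p , sub , len =
        fan-map (λ { (inj₁ q) → old q ; (inj₂ q) → new (in-ear (sub q)) }) par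
          (fan-extend (B Ha Hy (y≢a ∘ sym)) p (Adj-sym a~e) (out ∘ in-ear ∘ sub))
        where
        par : not (odd h) xor (χ a xor χ y) ≡ χ⁺ x xor χ⁺ y
        par = trans (cong (λ z → not z xor (χ a xor χ y)) (head-parity len))
              (trans (solve 4 (λ a b f y → (con true :+ ((a :+ b) :+ f)) :+ (a :+ y) := (b :+ (con true :+ f)) :+ y) refl
                        (χ a) (χ b) (odd (after es x)) (χ y))
                     (sym (cong₂ _xor_ (χ-in m) (χ-out λ m′ → out m′ Hy))))
      old-new {x} {y} m Hy | yes refl with tail-path ear m
      ...   | ts , p , sub =
        fan-map (λ { (inj₁ q) → old q ; (inj₂ q) → new (sub q) }) par
          (fan-extend (B Hb Ha (a≢b ∘ sym)) p e′~b (out ∘ sub))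
        where
        par : not (odd (after es x)) xor (χ b xor χ a) ≡ χ⁺ x xor χ⁺ a
        par = trans (solve 3 (λ a b f → (con true :+ f) :+ (b :+ a) := (b :+ (con true :+ f)) :+ a) refl
                        (χ a) (χ b) (odd (after es x)))
                     (sym (cong₂ _xor_ (χ-in m) (χ-out λ m′ → out m′ Ha)))

      -- The earlier vertex leaves the ear through `a` and the later one through `b`; the two outer
      -- pieces of the ear prolong the fan of `a` and `b`.
      new-new : ∀ {x y} (m : x ∈ es) (m′ : y ∈ es) (S : Split {e} {e′} es k x y) →
                (∀ {v} → v ∈ Split.hs S → v ∈ es) → (∀ {v} → v ∈ Split.ts S → v ∈ es) →
                Fan (H⁺ ∋_) x y (χ⁺ x xor χ⁺ y)
      new-new {x} {y} m m′ S sh st =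
        fan-sym (fan-map (λ { (inj₁ (inj₁ q)) → old q ; (inj₁ (inj₂ q)) → new (sh q) ; (inj₂ q) → new (st q) }) par
          (fan-extend (fan-sym (fan-extend (B Ha Hb a≢b) (Split.headₛ S) (Adj-sym a~e) (out ∘ sh)))
            (Split.tailₛ S) e′~b (λ { q (inj₁ r) → out (st q) r ; q (inj₂ r) → Split.apart S r q })))
        where
        par : not (odd (after es y)) xor (not (odd (Split.hlen S)) xor (χ a xor χ b)) ≡ χ⁺ x xor χ⁺ y
        par = trans (cong (λ z → not (odd (after es y)) xor (not z xor (χ a xor χ b))) (head-parity (Split.hlen≡ S)))
              (trans (solve 4 (λ a b f g → (con true :+ g) :+ ((con true :+ ((a :+ b) :+ f)) :+ (a :+ b)) := (b :+ (con true :+ f)) :+ (b :+ (con true :+ g))) refl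
                        (χ a) (χ b) (odd (after es x)) (odd (after es y)))
                     (sym (cong₂ _xor_ (χ-in m) (χ-in m′))))

      cases : ∀ {v} → H⁺ ∋ v → H ∋ v ⊎ v ∈ es
      cases {v} h with ∨-true h
      ... | inj₁ q = inj₁ q
      ... | inj₂ q with v ∈? es
      ...   | yes m = inj₂ m

    block⁺ : Block H⁺ χ⁺
    block⁺ {x} {y} hx hy x≢y with cases hx | cases hy
    ... | inj₁ p | inj₁ q = fan-map old
      (sym (cong₂ _xor_ (χ-out (λ m → out m p)) (χ-out (λ m → out m q)))) (B p q x≢y)
    ... | inj₂ p | inj₁ q = old-new p q
    ... | inj₁ p | inj₂ q = fan-map (λ z → z) (xor-comm (χ⁺ y) (χ⁺ x)) (fan-sym (old-new q p))
    ... | inj₂ p | inj₂ q with split-pair stop ear only-start p q x≢y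
    ...   | inj₁ (S , sh , st) = new-new p q S (in-ear ∘ sh) st
    ...   | inj₂ (S , sh , st) = fan-map (λ z → z) (xor-comm (χ⁺ y) (χ⁺ x)) (fan-sym (new-new q p S (in-ear ∘ sh) st))

  -- Connected components of a vertex set.

  Connected : VSet → Set
  Connected D = ∀ u v → D ∋ u → D ∋ v → ∃₂ λ k vs → SP u v k vs × (∀ {w} → w ∈ vs → D ∋ w)

  insert : V → VSet → VSet
  insert w D v = D v ∨ does (v Fin.≟ w)

  singleton-connected : ∀ v → Connected (λ w → does (w Fin.≟ v))
  singleton-connected v u w p q =
    0 , _ , subst (λ z → SP u z 0 (u ∷ [])) (trans (does-≡ p) (sym (does-≡ q))) stop , λ { (here refl) → p }

  insert-connected : ∀ {D u w} → Connected D → D ∋ u → ¬ D ∋ w → Adj u w → Connected (insert w D)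
  insert-connected {D} {u} {w} conn Du ¬Dw u~w x y p q with ∨-true p | ∨-true q
  ... | inj₁ p | inj₁ q = let k , vs , P , sub = conn x y p q in k , vs , P , true-∨ˡ ∘ sub
  ... | inj₂ p | inj₂ q = 0 , _ , subst (λ z → SP x z 0 (x ∷ [])) (trans (does-≡ p) (sym (does-≡ q))) stop ,
                          λ { (here refl) → true-∨ʳ (D x) p }
  ... | inj₂ p | inj₁ q with does-≡ {u = x} p | conn u y Du q
  ...   | refl | k , vs , P , sub = suc k , _ , step (Adj-sym u~w) (¬Dw ∘ sub) P ,
                          λ { (here refl) → true-∨ʳ (D w) p ; (there m) → true-∨ˡ (sub m) }
  insert-connected {D} {u} {w} conn Du ¬Dw u~w x y p q | inj₁ p′ | inj₂ q′ with does-≡ {u = y} q′ | conn x u p′ Du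
  ...   | refl | k , vs , P , sub = k + 1 , _ , append P u~w stop (λ { m (here refl) → ¬Dw (sub m) }) , sub′
    where
    sub′ : ∀ {v} → v ∈ vs ++ w ∷ [] → insert w D ∋ v
    sub′ m with ∈-++⁻ vs m
    ... | inj₁ m′          = true-∨ˡ (sub m′)
    ... | inj₂ (here refl) = true-∨ʳ (D w) q′

  insert-⊆ : ∀ {X D : VSet} {w} → (∀ {v} → D ∋ v → X ∋ v) → X ∋ w → ∀ {v} → insert w D ∋ v → X ∋ v
  insert-⊆ {X} {D} sub Xw {v} h with ∨-true {D v} h
  ... | inj₁ p = sub p
  ... | inj₂ p = subst (X ∋_) (sym (does-≡ p)) Xw

  _∖_ : VSet → VSet → VSet
  (X ∖ D) v = X v ∧ not (D v)

  ∖-intro : ∀ {X D v} → X ∋ v → ¬ D ∋ v → (X ∖ D) ∋ v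
  ∖-intro Xv ¬Dv = true-∧ Xv (cong not (¬-not ¬Dv))

  ∖-elim : ∀ {X D v} → (X ∖ D) ∋ v → X ∋ v × ¬ D ∋ v
  ∖-elim {X} {D} {v} h = let p , q = ∧-true {X v} h in p , λ Dv → clash Dv (not-true q)

  ∖-shrink : ∀ {X D D′ v} → (∀ {u} → D ∋ u → D′ ∋ u) → X ∋ v → ¬ D ∋ v → D′ ∋ v →
             count (X ∖ D′) < count (X ∖ D)
  ∖-shrink {X} {D} {D′} {v} sub Xv ¬Dv D′v = count-mono-< {b = X ∖ D′} {X ∖ D}
    (λ u h → let p , q = ∖-elim {X} {D′} h in ∖-intro {X} {D} p (q ∘ sub)) v
    (¬-not λ h → proj₂ (∖-elim {X} {D′} h) D′v) (∖-intro {X} {D} Xv ¬Dv)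

  record Component (X : VSet) (v : V) : Set where
    field
      D      : VSet
      root   : D ∋ v
      D⊆     : ∀ {u} → D ∋ u → X ∋ u
      conn   : Connected D
      closed : ∀ {u w} → D ∋ u → X ∋ w → Adj u w → D ∋ w

  component : ∀ X v → X ∋ v → Component X v
  component X v Xv = enlarge (suc (count (X ∖ D₀))) D₀ (does-refl v) singleton-⊆ (singleton-connected v) ≤-refl
    where
    D₀ : VSet
    D₀ w = does (w Fin.≟ v)
    singleton-⊆ : ∀ {u} → D₀ ∋ u → X ∋ u
    singleton-⊆ p = subst (X ∋_) (sym (does-≡ p)) Xv
    enlarge : ∀ fuel D → D ∋ v → (∀ {u} → D ∋ u → X ∋ u) → Connected D → count (X ∖ D) < fuel → Component X v
    enlarge (suc fuel) D Dv sub conn (s≤s le)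
      with Fin.any? (λ w → (X ∋? w) ×-dec (¬? (D ∋? w)) ×-dec Fin.any? (λ u → (D ∋? u) ×-dec Adj? u w))
    ... | yes (w , Xw , ¬Dw , u , Du , u~w) =
      enlarge fuel (insert w D) (true-∨ˡ Dv) (insert-⊆ {X} {D} sub Xw) (insert-connected conn Du ¬Dw u~w)
        (≤-trans (∖-shrink {X} {D} {insert w D} true-∨ˡ Xw ¬Dw (true-∨ʳ (D w) (does-refl w))) le)
    ... | no none = record { D = D ; root = Dv ; D⊆ = sub ; conn = conn ; closed = closed }
      where
      closed : ∀ {u w} → D ∋ u → X ∋ w → Adj u w → D ∋ w
      closed {u} {w} Du Xw u~w with D ∋? w
      ... | yes Dw = Dw
      ... | no ¬Dw = contradiction (w , Xw , ¬Dw , u , Du , u~w) none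

  -- Counted from the class without `h`, the edges of `U` number a multiple of `d`. Counted from the
  -- other class, every term except that of `h` is known to be a multiple.
  proper⇒∣-true : ∀ {U h} χ → Proper U χ → χ h ≡ true → U ∋ h →
                  (∀ {v} → U ∋ v → v ≢ h → d ∣ degIn U v) → d ∣ degIn U h
  proper⇒∣-true {U} {h} χ proper χh Uh dvs = subst (d ∣_) at-h
    (∣-sum-rest f h (λ v v≢h → scaled v v≢h (χ v)) (subst (d ∣_) (sym (double-count U χ proper)) (∣-sum g others)))
    where
    f g : V → ℕ
    f v = ⟦ U v ∧ χ v ⟧ * degIn U v
    g v = ⟦ U v ∧ not (χ v) ⟧ * degIn U v
    scaled : ∀ v → v ≢ h → ∀ x → d ∣ ⟦ U v ∧ x ⟧ * degIn U v
    scaled v v≢h x with U v in Uv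
    ... | true  = ∣n⇒∣m*n ⟦ x ⟧ (dvs Uv v≢h)
    ... | false = d ∣0
    at-h : f h ≡ degIn U h
    at-h rewrite Uh | χh = +-identityʳ _
    others : ∀ v → d ∣ g v
    others v with v Fin.≟ h
    ... | no v≢h = scaled v v≢h (not (χ v))
    ... | yes refl rewrite Uh | χh = d ∣0

  proper⇒∣ : ∀ {U χ h} → Proper U χ → U ∋ h → (∀ {v} → U ∋ v → v ≢ h → d ∣ degIn U v) → d ∣ degIn U h
  proper⇒∣ {U} {χ} {h} proper Uh dvs with χ h in χh
  ... | true  = proper⇒∣-true χ proper χh Uh dvs
  ... | false = proper⇒∣-true (not ∘ χ) (λ Uu Uv u~v e → proper Uu Uv u~v (not-injective e)) (cong not χh) Uh dvs

  -- A positive multiple of `d` is at least `d`, whereas a neighbour missing from `U` would leave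
  -- fewer than `d`.
  full-degree : ∀ U v → d ∣ degIn U v → 0 < degIn U v → ∀ {w} → Adj v w → U ∋ w
  full-degree U v dvs pos {w} v~w with U ∋? w
  ... | yes Uw = Uw
  ... | no ¬Uw = contradiction d≤ (<⇒≱ (≤-trans smaller (≤-reflexive (regular v))))
    where
    d≤ : d ≤ degIn U v
    d≤ = ∣⇒≤ {{>-nonZero pos}} dvs
    smaller : degIn U v < count (adj G v)
    smaller = count-mono-< {b = λ w → U w ∧ adj G v w} {adj G v} (λ u h → proj₂ (∧-true {U u} h)) w
                (cong (_∧ adj G v w) (¬-not ¬Uw)) v~w

  -- D hangs on the rest of U by the single vertex a, so U is the union of D ∪ {a} and U ∖ D glued at a.
  module Cut (U D : VSet) (a : V) (Ua : U ∋ a) (¬Da : ¬ D ∋ a) (D⊆U : ∀ {v} → D ∋ v → U ∋ v)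
    (only-a : ∀ {u v} → D ∋ u → U ∋ v → ¬ D ∋ v → Adj u v → v ≡ a) where

    U₁ U₂ : VSet
    U₁ = insert a D
    U₂ = U ∖ D

    U₁⊆U : ∀ {v} → U₁ ∋ v → U ∋ v
    U₁⊆U = insert-⊆ {U} {D} D⊆U Ua

    a∈U₁ : U₁ ∋ a
    a∈U₁ = true-∨ʳ (D a) (does-refl a)

    a∈U₂ : U₂ ∋ a
    a∈U₂ = ∖-intro {U} {D} Ua ¬Da

    bool-≡ : ∀ {x y : Bool} → (x ≡ true → y ≡ true) → (y ≡ true → x ≡ true) → x ≡ y
    bool-≡ {true}  {y} f g = sym (f refl)
    bool-≡ {false} {true} f g = g refl
    bool-≡ {false} {false} f g = refl

    deg₁ : ∀ {v} → D ∋ v → degIn U₁ v ≡ degIn U v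
    deg₁ {v} Dv = count-cong λ w → bool-≡ {U₁ w ∧ adj G v w}
      (λ h → let p , q = ∧-true {U₁ w} h in true-∧ (U₁⊆U p) q)
      (λ h → let p , q = ∧-true {U w} h in true-∧ (back p q) q)
      where
      back : ∀ {w} → U ∋ w → Adj v w → U₁ ∋ w
      back {w} Uw v~w with D ∋? w
      ... | yes Dw = true-∨ˡ Dw
      ... | no ¬Dw = true-∨ʳ (D w) (trans (cong (λ z → does (z Fin.≟ a)) (only-a Dv Uw ¬Dw v~w)) (does-refl a))

    deg₂ : ∀ {v} → U₂ ∋ v → v ≢ a → degIn U₂ v ≡ degIn U v
    deg₂ {v} U₂v v≢a = count-cong λ w → bool-≡ {U₂ w ∧ adj G v w}
      (λ h → let p , q = ∧-true {U₂ w} h in true-∧ (proj₁ (∖-elim {U} {D} p)) q)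
      (λ h → let p , q = ∧-true {U w} h in true-∧ (∖-intro {U} {D} p (λ Dw → v≢a (only-a Dw (proj₁ v∈) (proj₂ v∈) (Adj-sym q)))) q)
      where
      v∈ = ∖-elim {U} {D} U₂v

    deg-a : degIn U₁ a + degIn U₂ a ≡ degIn U a
    deg-a = trans (sym (∑-distrib-+ (λ w → ⟦ U₁ w ∧ adj G a w ⟧) _)) (sum-cong-≗ pointwise)
      where
      pointwise : ∀ w → ⟦ U₁ w ∧ adj G a w ⟧ + ⟦ U₂ w ∧ adj G a w ⟧ ≡ ⟦ U w ∧ adj G a w ⟧
      pointwise w with w Fin.≟ a
      -- `a` belongs to both pieces, but is not its own neighbour and so is not counted twice.
      ... | yes refl rewrite loopless G w | ∧-zeroʳ (D w ∨ true) | ∧-zeroʳ (U w ∧ not (D w)) | ∧-zeroʳ (U w) = refl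
      pointwise w | no _ with D w in Dw
      ...   | true rewrite D⊆U Dw = +-identityʳ _
      ...   | false with U w
      ...     | true  = refl
      ...     | false = refl

    glue : ∃ (Proper U₁) → ∃ (Proper U₂) → ∃ (Proper U)
    glue (χ₁ , proper₁) (χ₂ , proper₂) = χ , λ {u} {v} → proper {u} {v}
      where
      -- Exchanging the colours of the first piece when they disagree makes both colourings agree at
      -- `a`.
      δ : Bool
      δ = χ₁ a xor χ₂ a
      χ : V → Bool
      χ v = if D v then χ₁ v xor δ else χ₂ v
      xor-inj : ∀ x y z → x xor z ≡ y xor z → x ≡ y
      xor-inj true  true  z e = refl
      xor-inj false false z e = refl
      xor-inj true  false true  ()
      xor-inj true  false false ()
      xor-inj false true  true  ()
      xor-inj false true  false ()
      at-a : χ₂ a ≡ χ₁ a xor δ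
      at-a = sym (cancel (χ₁ a) (χ₂ a))
        where
        cancel : ∀ x y → x xor (x xor y) ≡ y
        cancel true  y = not-involutive y
        cancel false y = refl
      crossing : ∀ {u v} → D ∋ u → U ∋ v → ¬ D ∋ v → Adj u v → χ₁ u xor δ ≢ χ₂ v
      crossing Du Uv ¬Dv u~v e with only-a Du Uv ¬Dv u~v
      ... | refl = proper₁ (true-∨ˡ Du) a∈U₁ u~v (xor-inj _ _ δ (trans e at-a))
      proper : Proper U χ
      proper {u} {v} Uu Uv u~v e with D u in Du | D v in Dv
      ... | true  | true  = proper₁ (true-∨ˡ Du) (true-∨ˡ Dv) u~v (xor-inj _ _ δ e)
      ... | false | false = proper₂ (∖-intro {U} {D} Uu λ z → clash z Du) (∖-intro {U} {D} Uv λ z → clash z Dv) u~v e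
      ... | true  | false = crossing Du Uv (λ z → clash z Dv) u~v e
      ... | false | true  = crossing Dv Uu (λ z → clash z Du) (Adj-sym u~v) (sym e)

  -- The exception `h` makes the condition hereditary: a piece cut off at `a` satisfies it with `a`
  -- in place of `h`.
  Divisible : VSet → V → Set
  Divisible U h = ∀ {v} → U ∋ v → v ≢ h → d ∣ degIn U v

  -- One step of the recursion: grow a block or cut.

  module Step (U : VSet) (h : V) (dvs : Divisible U h)
    (smaller : ∀ U′ h′ → count U′ < count U → Divisible U′ h′ → ∃ (Proper U′)) where

    cut : ∀ {D a b v} → U ∋ a → ¬ D ∋ a → U ∋ b → ¬ D ∋ b → a ≢ b → D ∋ v → (∀ {v} → D ∋ v → U ∋ v) →
          (∀ {u v} → D ∋ u → U ∋ v → ¬ D ∋ v → Adj u v → v ≡ a) → ∃ (Proper U)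
    cut {D} {a} {b} {v} Ua ¬Da Ub ¬Db a≢b Dv D⊆U only-a = by-side (D ∋? h)
      where
      open Cut U D a Ua ¬Da D⊆U only-a
      small₁ : count U₁ < count U
      small₁ = count-mono-< {b = U₁} {U} (λ _ → U₁⊆U) b (¬-not λ q → bad (∨-true q)) Ub
        where
        bad : D ∋ b ⊎ does (b Fin.≟ a) ≡ true → ⊥
        bad (inj₁ q) = ¬Db q
        bad (inj₂ q) = a≢b (sym (does-≡ q))
      small₂ : count U₂ < count U
      small₂ = count-mono-< {b = U₂} {U} (λ _ q → proj₁ (∖-elim {U} {D} q)) v (¬-not λ q → proj₂ (∖-elim {U} {D} q) Dv) (D⊆U Dv)
      dvs₁ : ∀ {z} → D ∋ z → z ≢ h → d ∣ degIn U₁ z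
      dvs₁ Dz z≢h = subst (d ∣_) (sym (deg₁ Dz)) (dvs (D⊆U Dz) z≢h)
      dvs₂ : ∀ {z} → U₂ ∋ z → z ≢ a → z ≢ h → d ∣ degIn U₂ z
      dvs₂ q z≢a z≢h = subst (d ∣_) (sym (deg₂ q z≢a)) (dvs (proj₁ (∖-elim {U} {D} q)) z≢h)
      -- The piece that contains `h` at most as its cut vertex is coloured first, with `a` as the
      -- exception. By `proper⇒∣` its degree at `a` is a multiple of `d`; if `a` is not `h`, the
      -- other piece inherits this by `deg-a`, so there `h` remains the only exception.
      by-side : Dec (D ∋ h) → ∃ (Proper U)
      by-side (yes Dh) = glue (smaller U₁ h small₁ all₁) c₂
        where
        a≢h : a ≢ h
        a≢h refl = ¬Da Dh
        rest₂ : Divisible U₂ a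
        rest₂ q z≢a = dvs₂ q z≢a λ { refl → proj₂ (∖-elim {U} {D} q) Dh }
        c₂ = smaller U₂ a small₂ rest₂
        a∣ : d ∣ degIn U₁ a
        a∣ = ∣m+n∣m⇒∣n (subst (d ∣_) (trans (sym deg-a) (+-comm (degIn U₁ a) _)) (dvs Ua a≢h))
               (proper⇒∣ {U₂} (proj₂ c₂) a∈U₂ rest₂)
        all₁ : Divisible U₁ h
        all₁ q z≢h with ∨-true q
        ... | inj₁ Dz = dvs₁ Dz z≢h
        ... | inj₂ e = subst (λ z → d ∣ degIn U₁ z) (sym (does-≡ e)) a∣
      by-side (no ¬Dh) = glue c₁ (smaller U₂ h small₂ all₂)
        where
        rest₁ : Divisible U₁ a
        rest₁ q z≢a with ∨-true q
        ... | inj₁ Dz = dvs₁ Dz λ { refl → ¬Dh Dz }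
        ... | inj₂ e  = contradiction (does-≡ e) z≢a
        c₁ = smaller U₁ a small₁ rest₁
        all₂ : Divisible U₂ h
        all₂ {z} q z≢h with z Fin.≟ a
        ... | no z≢a   = dvs₂ q z≢a z≢h
        ... | yes refl = ∣m+n∣m⇒∣n (subst (d ∣_) (sym deg-a) (dvs Ua z≢h)) (proper⇒∣ {U₁} (proj₂ c₁) a∈U₁ rest₁)

    module _ {x y : V} (x≢y : x ≢ y) where

      -- Edges of `U` leave a component `D` of the uncoloured rest only towards `H`. Two distinct
      -- attachments give an ear through `D`; at most one gives a cut, and both pieces go to the
      -- recursion.
      grow : ∀ fuel H χ → Block H χ → (∀ {v} → H ∋ v → U ∋ v) → H ∋ x → H ∋ y → count (U ∖ H) < fuel → ∃ (Proper U)
      grow (suc fuel) H χ B H⊆U Hx Hy (s≤s le) with Fin.any? (λ v → (U ∖ H) ∋? v)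
      ... | no none = χ , λ Uu Uv → block-proper {H} {χ} B (inH Uu) (inH Uv)
        where
        inH : ∀ {v} → U ∋ v → H ∋ v
        inH {v} Uv with H ∋? v
        ... | yes Hv = Hv
        ... | no ¬Hv = contradiction (v , ∖-intro {U} {H} Uv ¬Hv) none
      ... | yes (v , Xv) = attach (Fin.any? λ a → Fin.any? λ e → (H ∋? a) ×-dec (D ∋? e) ×-dec Adj? a e)
        where
        open Component (component (U ∖ H) v Xv)
        D⊆U : ∀ {v} → D ∋ v → U ∋ v
        D⊆U Dv = proj₁ (∖-elim {U} {H} (D⊆ Dv))
        out : ∀ {v} → H ∋ v → ¬ D ∋ v
        out Hv Dv = proj₂ (∖-elim {U} {H} (D⊆ Dv)) Hv
        exits : ∀ {u v} → D ∋ u → U ∋ v → ¬ D ∋ v → Adj u v → H ∋ v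
        exits {u} {v} Du Uv ¬Dv u~v with H ∋? v
        ... | yes Hv = Hv
        ... | no ¬Hv = contradiction (closed Du (∖-intro {U} {H} Uv ¬Hv) u~v) ¬Dv
        hang : ∀ a → H ∋ a → (∀ {b e} → H ∋ b → D ∋ e → Adj b e → b ≡ a) → ∃ (Proper U)
        -- One of `x` and `y` differs from `a`. It lies in `H`, so it is missing from the piece
        -- around `D`, which is therefore smaller than `U`.
        hang a Ha single with a Fin.≟ x
        ... | yes refl = cut {D} (H⊆U Ha) (out Ha) (H⊆U Hy) (out Hy) x≢y root D⊆U
                           (λ Du Uv ¬Dv u~v → single (exits Du Uv ¬Dv u~v) Du (Adj-sym u~v))
        ... | no a≢x   = cut {D} (H⊆U Ha) (out Ha) (H⊆U Hx) (out Hx) a≢x root D⊆U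
                           (λ Du Uv ¬Dv u~v → single (exits Du Uv ¬Dv u~v) Du (Adj-sym u~v))
        attach : Dec (∃ λ a → ∃ λ e → H ∋ a × D ∋ e × Adj a e) → ∃ (Proper U)
        -- Without edges between `H` and `D`, any vertex of `H` may serve as the cut vertex.
        attach (no none) = hang x Hx λ {b} {e} Hb De b~e → contradiction (b , e , Hb , De , b~e) none
        attach (yes (a , e , Ha , De , a~e))
          with Fin.any? (λ b → Fin.any? λ e′ → ¬? (b Fin.≟ a) ×-dec (H ∋? b) ×-dec (D ∋? e′) ×-dec Adj? b e′)
        ... | no none = hang a Ha single
          where
          single : ∀ {b e} → H ∋ b → D ∋ e → Adj b e → b ≡ a
          single {b} {e} Hb De b~e with b Fin.≟ a
          ... | yes b≡a = b≡a
          ... | no b≢a  = contradiction (b , e , b≢a , Hb , De , b~e) none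
        ... | yes (b , e′ , b≢a , Hb , De′ , b~e′) with conn e e′ De De′
        ...   | k , es , ear , es⊆ = grow fuel H⁺ χ⁺ block⁺ H⁺⊆U (true-∨ˡ Hx) (true-∨ˡ Hy)
            (≤-trans (∖-shrink {U} {H} {H⁺} true-∨ˡ (D⊆U De) (λ He → out He De) He⁺) le)
          where
          open AddEar {H} {χ} B Ha Hb (b≢a ∘ sym) a~e ear (Adj-sym b~e′) (λ m Hv → out Hv (es⊆ m))
          He⁺ : H⁺ ∋ e
          He⁺ with e ∈? es
          ... | yes _ = true-∨ʳ (H e) refl
          ... | no ¬m = contradiction (start∈ ear) ¬m
          H⁺⊆U : ∀ {v} → H⁺ ∋ v → U ∋ v
          H⁺⊆U {v} q with ∨-true q
          ... | inj₁ Hv = H⊆U Hv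
          ... | inj₂ m with v ∈? es
          ...   | yes v∈ = D⊆U (es⊆ v∈)

    -- A vertex other than `h` with an edge in `U` has all its neighbours in `U`, among them a
    -- linked pair to grow from. If there is none, `U` has no edges, since every edge has an end
    -- other than `h`.
    colour-step : ∃ (Proper U)
    colour-step with Fin.any? (λ v → (U ∋? v) ×-dec ¬? (v Fin.≟ h) ×-dec (0 <? degIn U v))
    ... | no none = (λ _ → false) , λ {u} {v} Uu Uv u~v _ → edgeless Uu Uv u~v
      where
      positive : ∀ {u v} → U ∋ v → Adj u v → 0 < degIn U u
      positive {u} {v} Uv u~v = ≤-trans (≤-reflexive (sym (cong ⟦_⟧ (true-∧ Uv u~v)))) (term≤sum (λ w → ⟦ U w ∧ adj G u w ⟧) v)
      edgeless : ∀ {u v} → U ∋ u → U ∋ v → Adj u v → ⊥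
      edgeless {u} {v} Uu Uv u~v with u Fin.≟ h
      ... | no u≢h   = none (u , Uu , u≢h , positive Uv u~v)
      ... | yes refl = none (v , Uv , (λ { refl → Adj-irrefl u~v }) , positive Uu (Adj-sym u~v))
    ... | yes (v , Uv , v≢h , pos) with R-nbrs v
    ...   | x , y , v~x , v~y , x≢y , r =
      grow x≢y (suc (count (U ∖ H₀))) H₀ (λ _ → false) (edge-block x≢y r) H₀⊆U
        (true-∨ˡ (does-refl x)) (true-∨ʳ (does (y Fin.≟ x)) (does-refl y)) ≤-refl
      where
      H₀ : VSet
      H₀ v = does (v Fin.≟ x) ∨ does (v Fin.≟ y)
      H₀⊆U : ∀ {v} → H₀ ∋ v → U ∋ v
      H₀⊆U q with ∨-true q
      ... | inj₁ p = subst (U ∋_) (sym (does-≡ p)) (full-degree U v (dvs Uv v≢h) pos v~x)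
      ... | inj₂ p = subst (U ∋_) (sym (does-≡ p)) (full-degree U v (dvs Uv v≢h) pos v~y)

  colour : ∀ fuel U h → count U < fuel → Divisible U h → ∃ (Proper U)
  colour (suc fuel) U h (s≤s le) dvs =
    Step.colour-step U h dvs λ U′ h′ lt → colour fuel U′ h′ (≤-trans lt le)

-- Extremal graphs

-- The classes `x` and `y` differ by 1 modulo `M`; multiples of `M` on both sides replace
-- subtraction.
Near : ℕ → ℕ → ℕ → Set
Near M x y = ∃₂ λ a b → suc x + a * M ≡ y + b * M ⊎ x + a * M ≡ suc y + b * M

-- A closed walk makes p steps up and q steps down with p ≡ q mod 2ℓ + 1, although p + q = 2ℓ − 1 is odd.
near⇒free : ∀ {n} (G : Graph n) ℓ → 3 ≤ ℓ → (cls : Fin n → ℕ) →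
            (∀ u v → adj G u v ≡ true → Near (suc (2 * ℓ)) (cls u) (cls v)) →
            ¬ ContainsCycleSuc (2 * ℓ ∸ 2) G
near⇒free {n} G ℓ 3≤ℓ cls near (f , _ , edges) = contradiction closes λ { (p , q , a , b , len , e) → absurd p q a b len e }
  where
  M = suc (2 * ℓ)
  m = 2 * ℓ ∸ 2

  m+2 : m + 2 ≡ 2 * ℓ
  m+2 = 2ℓ∸2+2 3≤ℓ

  g : ℕ → Fin (suc m)
  g zero    = zero
  g (suc k) = cycSuc (g k)

  toℕ-g : ∀ k → k ≤ m → toℕ (g k) ≡ k
  toℕ-g zero    _ = refl
  toℕ-g (suc k) l = trans (cycSuc-step (g k) (≤-trans (s≤s (≤-reflexive ih)) l)) (cong suc ih)
    where ih = toℕ-g k (≤-trans (n≤1+n k) l)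

  c : ℕ → ℕ
  c k = cls (f (g k))

  Reach : ℕ → Set
  Reach k = ∃₂ λ p q → ∃₂ λ a b → p + q ≡ k × c 0 + p + a * M ≡ c k + q + b * M

  walk : ∀ k → Reach k
  walk zero    = 0 , 0 , 0 , 0 , refl , refl
  walk (suc k) with walk k | near (f (g k)) (f (g (suc k))) (Equivalence.to T-≡ (edges (g k)))
  ... | p , q , a , b , len , e | a′ , b′ , inj₁ s = suc p , q , a + a′ , b + b′ , cong suc len ,
    trans (left (c 0) p a a′ M) (trans (cong (λ z → suc z + a′ * M) e) (trans (mid (c k) q b a′ M)
      (trans (cong (λ z → z + q + b * M) s) (right (c (suc k)) q b b′ M))))
    where
    left : ∀ x p a a′ M → x + suc p + (a + a′) * M ≡ suc (x + p + a * M) + a′ * M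
    left = solve-∀
    mid : ∀ y q b a′ M → suc (y + q + b * M) + a′ * M ≡ suc y + a′ * M + q + b * M
    mid = solve-∀
    right : ∀ z q b b′ M → z + b′ * M + q + b * M ≡ z + q + (b + b′) * M
    right = solve-∀
  ... | p , q , a , b , len , e | a′ , b′ , inj₂ s = p , suc q , a + a′ , b + b′ , trans (+-suc p q) (cong suc len) ,
    trans (left (c 0) p a a′ M) (trans (cong (λ z → z + a′ * M) e) (trans (mid (c k) q b a′ M)
      (trans (cong (λ z → z + q + b * M) s) (right (c (suc k)) q b b′ M))))
    where
    left : ∀ x p a a′ M → x + p + (a + a′) * M ≡ (x + p + a * M) + a′ * M
    left = solve-∀
    mid : ∀ y q b a′ M → (y + q + b * M) + a′ * M ≡ y + a′ * M + q + b * M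
    mid = solve-∀
    right : ∀ z q b b′ M → suc z + b′ * M + q + b * M ≡ z + suc q + (b + b′) * M
    right = solve-∀

  closes : ∃₂ λ p q → ∃₂ λ a b → p + q ≡ suc m × c 0 + p + a * M ≡ c 0 + q + b * M
  closes with walk (suc m)
  ... | p , q , a , b , len , e = p , q , a , b , len ,
    subst (λ v → c 0 + p + a * M ≡ cls (f v) + q + b * M) (cycSuc-last (g m) (toℕ-g m ≤-refl)) e

  absurd : ∀ p q a b → p + q ≡ suc m → c 0 + p + a * M ≡ c 0 + q + b * M → ⊥
  absurd p q a b len e = contradiction (trans (sym len-even) len-odd) λ ()
    where
    p<M : p < M
    p<M = s≤s (≤-trans (m≤m+n p q) (≤-trans (≤-reflexive len) (≤-trans (≤-trans (m≤m+n (suc m) 1) (≤-reflexive (sym (+-suc m 1)))) (≤-reflexive m+2))))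
    q<M : q < M
    q<M = s≤s (≤-trans (m≤n+m q p) (≤-trans (≤-reflexive len) (≤-trans (≤-trans (m≤m+n (suc m) 1) (≤-reflexive (sym (+-suc m 1)))) (≤-reflexive m+2))))
    e′ : p + a * M ≡ q + b * M
    e′ = +-cancelˡ-≡ (c 0) _ _ (trans (sym (+-assoc (c 0) p _)) (trans e (+-assoc (c 0) q _)))
    p≡q : p ≡ q
    p≡q = begin
      p               ≡⟨ m<n⇒m%n≡m p<M ⟨
      p % M           ≡⟨ [m+kn]%n≡m%n p a M ⟨
      (p + a * M) % M ≡⟨ cong (_% M) e′ ⟩
      (q + b * M) % M ≡⟨ [m+kn]%n≡m%n q b M ⟩
      q % M           ≡⟨ m<n⇒m%n≡m q<M ⟩
      q               ∎
      where open ≡-Reasoning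
    len-even : odd (p + q) ≡ false
    len-even = trans (cong (λ z → odd (z + q)) p≡q) (odd-double q)
    len-odd : odd (p + q) ≡ true
    len-odd = trans (cong odd len) (cong not (trans (sym (not-involutive (odd m)))
      (trans (cong odd (trans (+-comm 2 m) m+2)) (odd-2* ℓ))))

-- Even order: the balanced complete bipartite graph.

parityGraph : ∀ n → Graph n
parityGraph n = record
  { adj       = λ u v → odd (toℕ u) xor odd (toℕ v)
  ; symmetric = λ u v → xor-comm (odd (toℕ u)) (odd (toℕ v))
  ; loopless  = λ v → xor-same (odd (toℕ v))
  }

parityGraph-degree : ∀ k c → count {k * 2} (λ u → c xor odd (toℕ u)) ≡ k
parityGraph-degree zero    c = refl
parityGraph-degree (suc k) c = trans (sym (+-assoc ⟦ c xor false ⟧ ⟦ c xor true ⟧ _)) (cong₂ _+_ (pair c)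
  (trans (count-cong {k * 2} λ u → cong (c xor_) (not-involutive (odd (toℕ u)))) (parityGraph-degree k c)))
  where
  pair : ∀ c → ⟦ c xor false ⟧ + ⟦ c xor true ⟧ ≡ 1
  pair true  = refl
  pair false = refl

parityGraph-near : ∀ {n} M (u v : Fin n) → adj (parityGraph n) u v ≡ true →
                   Near M ⟦ odd (toℕ u) ⟧ ⟦ odd (toℕ v) ⟧
parityGraph-near M u v a with odd (toℕ u) | odd (toℕ v)
... | true  | false = 0 , 0 , inj₂ refl
... | false | true  = 0 , 0 , inj₁ refl

-- Sums over classes and degrees in circulants.

sum-split : ∀ a {b} (f : Fin (a + b) → ℕ) → sum f ≡ sum (λ i → f (i ↑ˡ b)) + sum (λ i → f (a ↑ʳ i))
sum-split zero    f = refl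
sum-split (suc a) f = trans (cong (f zero +_) (sum-split a (f ∘ suc))) (sym (+-assoc (f zero) _ _))

∑< : ℕ → (ℕ → ℕ) → ℕ
∑< zero    g = 0
∑< (suc M) g = ∑< M g + g M

∑<-zero : ∀ M g → (∀ i → i < M → g i ≡ 0) → ∑< M g ≡ 0
∑<-zero zero    g h = refl
∑<-zero (suc M) g h = cong₂ _+_ (∑<-zero M g λ i l → h i (m≤n⇒m≤1+n l)) (h M ≤-refl)

∑<-one : ∀ M g k → k < M → (∀ i → i < M → i ≢ k → g i ≡ 0) → ∑< M g ≡ g k
∑<-one (suc M) g k k<M h with k ≟ M
... | yes refl = cong (_+ g k) (∑<-zero M g λ i l → h i (m≤n⇒m≤1+n l) (<⇒≢ l))
... | no k≢M   = trans (cong₂ _+_ (∑<-one M g k (≤∧≢⇒< (s≤s⁻¹ k<M) k≢M) λ i l → h i (m≤n⇒m≤1+n l)) (h M ≤-refl (k≢M ∘ sym)))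
                       (+-identityʳ _)

∑<-two : ∀ M g j k → j ≢ k → j < M → k < M → (∀ i → i < M → i ≢ j → i ≢ k → g i ≡ 0) → ∑< M g ≡ g j + g k
∑<-two (suc M) g j k j≢k j<M k<M h with j ≟ M | k ≟ M
... | yes refl | yes refl = contradiction refl j≢k
... | no j≢M   | yes refl = cong (_+ g k) (∑<-one M g j (≤∧≢⇒< (s≤s⁻¹ j<M) j≢M) λ i l i≢j → h i (m≤n⇒m≤1+n l) i≢j (<⇒≢ l))
... | yes refl | no k≢M   = trans (cong (_+ g j) (∑<-one M g k (≤∧≢⇒< (s≤s⁻¹ k<M) k≢M) λ i l → h i (m≤n⇒m≤1+n l) (<⇒≢ l)))
                                  (+-comm (g k) (g j))
... | no j≢M   | no k≢M   = trans (cong₂ _+_ (∑<-two M g j k j≢k (≤∧≢⇒< (s≤s⁻¹ j<M) j≢M) (≤∧≢⇒< (s≤s⁻¹ k<M) k≢M)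
                                                λ i l → h i (m≤n⇒m≤1+n l)) (h M ≤-refl (j≢M ∘ sym) (k≢M ∘ sym)))
                                  (+-identityʳ _)

sum-last : ∀ S (h : ℕ → ℕ) → sum {suc S} (λ q → h (toℕ q)) ≡ sum {S} (λ q → h (toℕ q)) + h S
sum-last zero    h = +-comm (h 0) 0
sum-last (suc S) h = trans (cong (h 0 +_) (sum-last S (h ∘ suc))) (sym (+-assoc (h 0) _ _))

-- Shifting the window by one trades `h 0` for `h S`, and these agree by periodicity.
rotate : ∀ S (h : ℕ → ℕ) → (∀ i → h (i + S) ≡ h i) → ∀ p →
         sum {S} (λ q → h (p + toℕ q)) ≡ sum {S} (λ q → h (toℕ q))
rotate S h per zero    = refl
rotate S h per (suc p) = trans (rotate S (h ∘ suc) (per ∘ suc) p)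
  (+-cancelˡ-≡ (h 0) _ _ (trans (sum-last S h) (trans (cong (sum {S} (λ q → h (toℕ q)) +_) (per 0)) (+-comm _ (h 0)))))

count-below : ∀ S D → D ≤ S → count {S} (λ q → toℕ q <ᵇ D) ≡ D
count-below S       zero    _       = sum-≡0 {S} λ _ → refl
count-below (suc S) (suc D) (s≤s l) = cong suc (count-below S D l)

-- Joining `p` to `q` when `p + q` is below `D` modulo `S` gives a `D`-regular bipartite graph
-- between two classes of size `S`. Taking the sum instead of the difference makes the rule
-- symmetric.
circulant : ∀ S .{{_ : NonZero S}} D → D ≤ S → ∀ p → count {S} (λ q → (p + toℕ q) % S <ᵇ D) ≡ D
circulant S D D≤S p = trans (rotate S (λ x → ⟦ x % S <ᵇ D ⟧) (λ i → cong (λ z → ⟦ z <ᵇ D ⟧) ([m+n]%n≡m%n i S)) p)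
  (trans (count-cong {S} (λ q → cong (_<ᵇ D) (m<n⇒m%n≡m (Fin.toℕ<n q)))) (count-below S D D≤S))

-- Classes 0, …, L of sizes s, consecutive ones completely joined, classes L and 0 joined by a circulant.
module BlowUp (e x y L : ℕ) (x≤ : suc x ≤ e + e) (y≤ : y ≤ e + e) (2≤L : 2 ≤ L) where

  -- The two classes next to an inner class must have `e + e` vertices together, so two sizes
  -- determine all others and the sizes have period 4. The form `suc x` makes reduction modulo `s 0`
  -- legitimate.
  s : ℕ → ℕ
  s 0             = suc x
  s 1             = y
  s (suc (suc i)) = (e + e) ∸ s i

  s≤ : ∀ i → s i ≤ e + e
  s≤ 0             = x≤
  s≤ 1             = y≤
  s≤ (suc (suc i)) = m∸n≤m (e + e) (s i)

  s-opposite : ∀ i → s i + s (suc (suc i)) ≡ e + e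
  s-opposite i = m+[n∸m]≡n (s≤ i)

  -- What classes 0 and `L` still lack: each already has `y` neighbours in its other adjacent class.
  D : ℕ
  D = (e + e) ∸ y

  total : ℕ → ℕ
  total zero    = 0
  total (suc M) = total M + s M

  loc : ∀ M → Fin (total M) → ℕ × ℕ
  loc (suc M) v = [ loc M , (λ q → M , toℕ q) ]′ (splitAt (total M) v)

  loc< : ∀ M v → proj₁ (loc M v) < M
  loc< (suc M) v with splitAt (total M) v
  ... | inj₁ u = m≤n⇒m≤1+n (loc< M u)
  ... | inj₂ q = ≤-refl

  sum-loc : ∀ M (F : ℕ × ℕ → ℕ) → sum (λ v → F (loc M v)) ≡ ∑< M (λ i → sum {s i} (λ q → F (i , toℕ q)))
  sum-loc zero    F = refl
  sum-loc (suc M) F = trans (sum-split (total M) {s M} (λ v → F (loc (suc M) v))) (cong₂ _+_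
    (trans (sum-cong-≗ λ i → cong (F ∘ [ loc M , (λ q → M , toℕ q) ]′) (Fin.splitAt-↑ˡ (total M) i (s M))) (sum-loc M F))
    (sum-cong-≗ {s M} λ i → cong (F ∘ [ loc M , (λ q → M , toℕ q) ]′) (Fin.splitAt-↑ʳ (total M) (s M) i)))

  s-periodic : ∀ t i → s (t * 4 + i) ≡ s i
  s-periodic zero    i = refl
  s-periodic (suc t) i = trans (m∸[m∸n]≡n (s≤ (t * 4 + i))) (s-periodic t i)

  total-periodic : ∀ t i → total (t * 4 + i) ≡ total i + t * (4 * e)
  total-periodic zero    i = sym (+-identityʳ (total i))
  total-periodic (suc t) i = begin
    total M + s M + s (suc M) + s (2 + M) + s (3 + M)   ≡⟨ regroup (total M) (s M) (s (suc M)) (s (2 + M)) (s (3 + M)) ⟩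
    total M + ((s M + s (2 + M)) + (s (suc M) + s (3 + M)))
      ≡⟨ cong₂ (λ u v → total M + (u + v)) (s-opposite M) (s-opposite (suc M)) ⟩
    total M + ((e + e) + (e + e))                       ≡⟨ cong (_+ ((e + e) + (e + e))) (total-periodic t i) ⟩
    total i + t * (4 * e) + ((e + e) + (e + e))         ≡⟨ collect (total i) t e ⟩
    total i + suc t * (4 * e)                           ∎
    where
    open ≡-Reasoning
    M = t * 4 + i
    regroup : ∀ a b c d f → a + b + c + d + f ≡ a + ((b + d) + (c + f))
    regroup = solve-∀
    collect : ∀ a t e → a + t * (4 * e) + ((e + e) + (e + e)) ≡ a + suc t * (4 * e)
    collect = solve-∀

  ends : ℕ → ℕ → Bool
  ends i j = ((i ≡ᵇ 0) ∧ (j ≡ᵇ L)) ∨ ((i ≡ᵇ L) ∧ (j ≡ᵇ 0))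

  near-end : ℕ → ℕ → Bool
  near-end p q = (p + q) % s 0 <ᵇ D

  A : ℕ × ℕ → ℕ × ℕ → Bool
  A (i , p) (j , q) = ((j ≡ᵇ suc i) ∨ (i ≡ᵇ suc j)) ∨ (ends i j ∧ near-end p q)

  A-sym : ∀ u v → A u v ≡ A v u
  A-sym (i , p) (j , q) = cong₂ _∨_ (∨-comm ((j ≡ᵇ suc i)) _) (cong₂ _∧_
    (trans (∨-comm ((i ≡ᵇ 0) ∧ (j ≡ᵇ L)) _) (cong₂ _∨_ (∧-comm ((i ≡ᵇ L)) _) (∧-comm ((i ≡ᵇ 0)) _)))
    (cong (λ z → z % s 0 <ᵇ D) (+-comm p q)))

  A-far : ∀ i j p q → j ≢ suc i → i ≢ suc j → ¬ (i ≡ 0 × j ≡ L) → ¬ (i ≡ L × j ≡ 0) → A (i , p) (j , q) ≡ false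
  A-far i j p q ¬up ¬down ¬0L ¬L0
    rewrite dec-false (j ≟ suc i) ¬up | dec-false (i ≟ suc j) ¬down = cong (_∧ near-end p q) no-ends
    where
    no-ends : ends i j ≡ false
    no-ends with i ≡ᵇ 0 in a | j ≡ᵇ L in b | i ≡ᵇ L in c | j ≡ᵇ 0 in f
    ... | true  | true  | _     | _     = contradiction (≡ᵇ-true a , ≡ᵇ-true b) ¬0L
    ... | _     | _     | true  | true  = contradiction (≡ᵇ-true c , ≡ᵇ-true f) ¬L0
    ... | false | _     | false | _     = refl
    ... | false | _     | true  | false = refl
    ... | true  | false | false | _     = refl
    ... | true  | false | true  | false = refl

  A-irrefl : ∀ v → A v v ≡ false
  A-irrefl (i , p) = A-far i i p p (<⇒≢ ≤-refl) (<⇒≢ ≤-refl)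
    (λ { (refl , refl) → contradiction 2≤L λ () }) (λ { (refl , refl) → contradiction 2≤L λ () })

  A-up : ∀ i p q → A (i , p) (suc i , q) ≡ true
  A-up i p q rewrite dec-true (suc i ≟ suc i) refl = refl

  A-down : ∀ i p q → A (suc i , p) (i , q) ≡ true
  A-down i p q = trans (A-sym (suc i , p) (i , q)) (A-up i q p)

  A-0L : ∀ p q → A (0 , p) (L , q) ≡ near-end p q
  A-0L p q rewrite dec-false (L ≟ 1) (λ { refl → contradiction 2≤L λ { (s≤s ()) } }) | dec-true (L ≟ L) refl = refl

  A-L0 : ∀ p q → A (L , p) (0 , q) ≡ near-end p q
  A-L0 p q = trans (A-sym (L , p) (0 , q)) (trans (A-0L q p) (cong (λ z → z % s 0 <ᵇ D) (+-comm q p)))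

  module _ (D≤ : D ≤ s 0) (s-last : s L ≡ s 0) (s-pred : ∀ {k} → suc k ≡ L → s k ≡ y) where

    joined : ∀ i p j → ℕ
    joined i p j = sum {s j} (λ q → ⟦ A (i , p) (j , toℕ q) ⟧)

    joined-full : ∀ i p j → (∀ q → A (i , p) (j , q) ≡ true) → joined i p j ≡ s j
    joined-full i p j h = trans (sum-cong-≗ {s j} λ q → cong ⟦_⟧ (h (toℕ q))) (trans (sum-const (s j) 1) (*-identityʳ (s j)))

    joined-none : ∀ i p j → (∀ q → A (i , p) (j , q) ≡ false) → joined i p j ≡ 0
    joined-none i p j h = sum-≡0 {s j} λ q → cong ⟦_⟧ (h (toℕ q))

    joined-end : ∀ i p j → s j ≡ s 0 → (∀ q → A (i , p) (j , q) ≡ near-end p q) → joined i p j ≡ D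
    joined-end i p j sj h = trans (sum-cong-≗ {s j} λ q → cong ⟦_⟧ (h (toℕ q)))
      (trans (cong (λ z → sum {z} (λ q → ⟦ near-end p (toℕ q) ⟧)) sj) (circulant (s 0) D D≤ p))

    y+D : y + D ≡ e + e
    y+D = m+[n∸m]≡n y≤

    degree-A : ∀ i p → i < suc L → ∑< (suc L) (joined i p) ≡ e + e
    degree-A zero p _ = trans (∑<-two (suc L) (joined 0 p) 1 L (λ { refl → contradiction 2≤L λ { (s≤s ()) } })
        (s≤s (≤-trans (n≤1+n 1) 2≤L)) ≤-refl
        (λ j _ j≢1 j≢L → joined-none 0 p j λ q → A-far 0 j p q j≢1 (λ ()) (j≢L ∘ proj₂) (λ { (refl , _) → contradiction 2≤L λ () })))
      (trans (cong₂ _+_ (joined-full 0 p 1 (A-up 0 p)) (joined-end 0 p L s-last (A-0L p))) y+D)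
    degree-A (suc i) p l with suc i ≟ L
    ... | yes refl = trans (∑<-two (suc L) (joined L p) i 0 (λ { refl → contradiction 2≤L λ { (s≤s ()) } })
        (n≤1+n _) (s≤s z≤n)
        (λ j j< j≢i j≢0 → joined-none (suc i) p j λ q → A-far (suc i) j p q (<⇒≢ j<) (j≢i ∘ sym ∘ suc-injective) (λ ()) (j≢0 ∘ proj₂)))
      (trans (cong₂ _+_ (trans (joined-full (suc i) p i (A-down i p)) (s-pred refl)) (joined-end (suc i) p 0 refl (A-L0 p))) y+D)
    ... | no i≢L = trans (∑<-two (suc L) (joined (suc i) p) i (suc (suc i)) (<⇒≢ (s≤s (n≤1+n _)))
        (≤-trans (n≤1+n _) l) (s≤s (≤∧≢⇒< (s≤s⁻¹ l) i≢L))
        (λ j _ j≢i j≢2 → joined-none (suc i) p j λ q → A-far (suc i) j p q j≢2 (j≢i ∘ sym ∘ suc-injective) (λ ()) (i≢L ∘ proj₁)))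
      (trans (cong₂ _+_ (joined-full (suc i) p i (A-down i p)) (joined-full (suc i) p (suc (suc i)) (A-up (suc i) p))) (s-opposite i))

    blowUp : Graph (total (suc L))
    blowUp = record
      { adj       = λ u v → A (loc (suc L) u) (loc (suc L) v)
      ; symmetric = λ u v → A-sym (loc (suc L) u) (loc (suc L) v)
      ; loopless  = λ v → A-irrefl (loc (suc L) v)
      }

    blowUp-degree : ∀ v → count (adj blowUp v) ≡ e + e
    blowUp-degree v = trans (sum-loc (suc L) (λ u → ⟦ A (loc (suc L) v) u ⟧))
      (degree-A (proj₁ (loc (suc L) v)) (proj₂ (loc (suc L) v)) (loc< (suc L) v))

    blowUp-near : ∀ u v → adj blowUp u v ≡ true → Near (suc L) (proj₁ (loc (suc L) u)) (proj₁ (loc (suc L) v))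
    blowUp-near u v = near (loc (suc L) u) (loc (suc L) v)
      where
      near : ∀ u v → A u v ≡ true → Near (suc L) (proj₁ u) (proj₁ v)
      near (i , p) (j , q) a with j ≡ᵇ suc i in up | i ≡ᵇ suc j in down
      ... | true  | _    = 0 , 0 , inj₁ (cong (_+ 0) (sym (≡ᵇ-true up)))
      ... | false | true = 0 , 0 , inj₂ (cong (_+ 0) (≡ᵇ-true down))
      ... | false | false with i ≡ᵇ 0 in i0 | j ≡ᵇ L in jL | i ≡ᵇ L in iL | j ≡ᵇ 0 in j0
      ...   | true | true | _ | _ = 1 , 0 , inj₂ (trans (cong₂ (λ z w → z + (suc w + 0)) (≡ᵇ-true i0) (sym (≡ᵇ-true jL))) refl)
      ...   | _ | _ | true | true = 0 , 1 , inj₁ (trans (cong (λ z → suc z + 0) (≡ᵇ-true iL)) (cong (_+ (suc L + 0)) (sym (≡ᵇ-true j0))))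
      ...   | false | _     | false | _     = contradiction a λ ()
      ...   | false | _     | true  | false = contradiction a λ ()
      ...   | true  | false | false | _     = contradiction a λ ()
      ...   | true  | false | true  | false = contradiction a λ ()

Example : ℕ → ℕ → ℕ → Set
Example ℓ k n = Σ (Graph n) λ G → Regular k G × ¬ ContainsCycleSuc (2 * ℓ ∸ 2) G

mkExample : ∀ {ℓ k n} → 3 ≤ ℓ → (G : Graph n) (cls : Fin n → ℕ) → (∀ v → count (adj G v) ≡ k) →
            (∀ u v → adj G u v ≡ true → Near (suc (2 * ℓ)) (cls u) (cls v)) → Example ℓ k n
mkExample {ℓ} 3≤ℓ G cls deg near = G , (λ v → trans (degree≡count G v) (deg v)) , near⇒free G ℓ 3≤ℓ cls near

-- Closing up requires `s L` to equal `s 0`. As the sizes have period 4, L = 2ℓ has residue 0 or 2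
-- according to the parity of ℓ. So the sizes e + r and e - r alternate on the even classes for even
-- ℓ and on the odd classes for odd ℓ; all other classes have size e. Either way one surplus `r`
-- survives in the total.
blowUp-example : ∀ ℓ → 3 ≤ ℓ → ∀ e r → 0 < e → r ≤ e → Example ℓ (e + e) (r + e * suc (2 * ℓ))
blowUp-example ℓ 3≤ℓ e@(suc e′) r _ r≤e = by-parity (odd ℓ) refl
  where
  2≤L : 2 ≤ 2 * ℓ
  2≤L = ≤-trans (s≤s (s≤s z≤n)) (*-monoʳ-≤ 2 (≤-trans (s≤s z≤n) 3≤ℓ))

  by-parity : ∀ b → odd ℓ ≡ b → Example ℓ (e + e) (r + e * suc (2 * ℓ))
  by-parity false o = subst (Example ℓ (e + e)) size
    (mkExample {ℓ} 3≤ℓ (blowUp D≤ s-last s-pred) _ (blowUp-degree D≤ s-last s-pred) (blowUp-near D≤ s-last s-pred))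
    where
    t = proj₁ (half ℓ o)
    x≤ : e + r ≤ e + e
    x≤ = +-monoʳ-≤ e r≤e
    open BlowUp e (e′ + r) e (2 * ℓ) x≤ (m≤m+n e e) 2≤L
    L≡ : 2 * ℓ ≡ t * 4 + 0
    L≡ = trans (cong (2 *_) (proj₂ (half ℓ o))) (quadruple t)
      where
      quadruple : ∀ t → 2 * (t + t) ≡ t * 4 + 0
      quadruple = solve-∀
    D≤ : D ≤ s 0
    D≤ = ≤-trans (≤-reflexive (m+n∸n≡m e e)) (m≤m+n e r)
    s-last : s (2 * ℓ) ≡ s 0
    s-last = trans (cong s L≡) (s-periodic t 0)
    s-odd : ∀ t → s (suc (t + t)) ≡ e
    s-odd zero    = refl
    s-odd (suc t) = trans (cong (λ k → s (suc (suc k))) (+-suc t t)) (trans (cong ((e + e) ∸_) (s-odd t)) (m+n∸n≡m e e))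
    s-pred : ∀ {k} → suc k ≡ 2 * ℓ → s k ≡ e
    s-pred {k} q = trans (cong s (proj₂ k-odd)) (s-odd (proj₁ k-odd))
      where
      k-odd : ∃ λ j → k ≡ suc (j + j)
      k-odd = half-odd k (trans (sym (not-involutive (odd k))) (cong not (trans (cong odd q) (odd-2* ℓ))))
    size : total (suc (2 * ℓ)) ≡ r + e * suc (2 * ℓ)
    size = trans (cong total (trans (cong suc L≡) (sym (+-suc (t * 4) 0)))) (trans (total-periodic t 1)
      (trans (arith t e r) (cong (λ z → r + e * suc z) (sym L≡))))
      where
      arith : ∀ t e r → e + r + t * (4 * e) ≡ r + e * suc (t * 4 + 0)
      arith = solve-∀
  by-parity true o = subst (Example ℓ (e + e)) size
    (mkExample {ℓ} 3≤ℓ (blowUp D≤ s-last s-pred) _ (blowUp-degree D≤ s-last s-pred) (blowUp-near D≤ s-last s-pred))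
    where
    ℓ-half = half-odd ℓ o
    t = proj₁ ℓ-half
    y≤ : e + r ≤ e + e
    y≤ = +-monoʳ-≤ e r≤e
    open BlowUp e e′ (e + r) (2 * ℓ) (m≤m+n e e) y≤ 2≤L
    L≡ : 2 * ℓ ≡ t * 4 + 2
    L≡ = trans (cong (2 *_) (proj₂ ℓ-half)) (quadruple t)
      where
      quadruple : ∀ t → 2 * suc (t + t) ≡ t * 4 + 2
      quadruple = solve-∀
    D≤ : D ≤ s 0
    D≤ = ≤-trans (≤-reflexive ([m+n]∸[m+o]≡n∸o e e r)) (m∸n≤m e r)
    s-last : s (2 * ℓ) ≡ s 0
    s-last = trans (cong s L≡) (trans (s-periodic t 2) (m+n∸n≡m e e))
    s-pred : ∀ {k} → suc k ≡ 2 * ℓ → s k ≡ e + r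
    s-pred q = trans (cong s (suc-injective (trans q (trans L≡ (+-suc (t * 4) 1))))) (s-periodic t 1)
    size : total (suc (2 * ℓ)) ≡ r + e * suc (2 * ℓ)
    size = trans (cong total (trans (cong suc L≡) (sym (+-suc (t * 4) 2)))) (trans (total-periodic t 3)
      (trans (cong (λ z → e + (e + r) + z + t * (4 * e)) (m+n∸n≡m e e))
      (trans (arith t e r) (cong (λ z → r + e * suc z) (sym L≡)))))
      where
      arith : ∀ t e r → e + (e + r) + e + t * (4 * e) ≡ r + e * suc (t * 4 + 2)
      arith = solve-∀

-- From density to bipartiteness and the bound on the degree.

regular-bipartite : ∀ {n} (G : Graph n) d → 0 < d → Fin n → (∀ v → count (adj G v) ≡ d) →
  ∀ χ → Subsets.Proper G (λ _ → true) χ → ∃ λ k → n ≡ k + k × d ≤ k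
regular-bipartite {n} G d 0<d v₀ regular χ proper = count χ , n≡ , d≤
  where
  open Subsets G

  weigh : ∀ (b : Fin n → Bool) → sum (λ v → ⟦ b v ⟧ * count (adj G v)) ≡ d * count b
  weigh b = trans (sum-cong-≗ λ v → trans (cong (⟦ b v ⟧ *_) (regular v)) (*-comm ⟦ b v ⟧ d)) (sum-*ˡ d (λ v → ⟦ b v ⟧))

  balanced : count χ ≡ count (not ∘ χ)
  balanced = *-cancelˡ-≡ _ _ d {{>-nonZero 0<d}}
    (trans (sym (weigh χ)) (trans (double-count (λ _ → true) χ proper) (weigh (not ∘ χ))))

  n≡ : n ≡ count χ + count χ
  n≡ = sym (begin
    count χ + count χ                  ≡⟨ cong (count χ +_) balanced ⟩
    count χ + count (not ∘ χ)          ≡⟨ ∑-distrib-+ (λ v → ⟦ χ v ⟧) _ ⟨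
    sum (λ v → ⟦ χ v ⟧ + ⟦ not (χ v) ⟧) ≡⟨ sum-cong-≗ (λ v → one (χ v)) ⟩
    sum {n} (λ _ → 1)                  ≡⟨ trans (sum-const n 1) (*-identityʳ n) ⟩
    n                                  ∎)
    where
    open ≡-Reasoning
    one : ∀ b → ⟦ b ⟧ + ⟦ not b ⟧ ≡ 1
    one true  = refl
    one false = refl

  d≤ : d ≤ count χ
  d≤ with χ v₀ in c
  ... | false = ≤-trans (≤-reflexive (sym (regular v₀))) (count-mono {b = adj G v₀} {χ} λ v a → ≢false (λ e → proper refl refl a (trans c (sym e))))
    where
    ≢false : ∀ {b} → b ≢ false → b ≡ true
    ≢false {true}  _ = refl
    ≢false {false} h = contradiction refl h
  ... | true = ≤-trans (≤-reflexive (sym (regular v₀))) (≤-trans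
    (count-mono {b = adj G v₀} {not ∘ χ} λ v a → cong not (¬-not (λ e → proper refl refl a (trans c (sym e))))) (≤-reflexive (sym balanced)))

dense⇒bipartite : ∀ {n} (G : Graph n) ℓ d → 3 ≤ ℓ → Fin n → (∀ v → count (adj G v) ≡ d) →
  2 * n < suc (2 * ℓ) * d → 2 * (suc ℓ * (suc ℓ * (3 * ℓ))) ≤ d → ¬ ContainsCycleSuc (2 * ℓ ∸ 2) G →
  ∃ λ k → n ≡ k + k × d ≤ k
dense⇒bipartite {n} G ℓ d 3≤ℓ v₀ regular dense large free =
  regular-bipartite G d (≤-trans (s≤s z≤n) ℓ<d) v₀ regular (proj₁ coloured) (proj₂ coloured)
  where
  open Dense G ℓ d 3≤ℓ regular dense large
  open SimplePaths G using (SP; SP⇒Path)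

  0<ℓ : 0 < ℓ
  0<ℓ = ≤-trans (s≤s z≤n) 3≤ℓ

  ℓ<d : suc ℓ ≤ d
  ℓ<d = begin
    suc ℓ                              ≡⟨ *-identityʳ (suc ℓ) ⟨
    suc ℓ * 1                          ≤⟨ *-monoʳ-≤ (suc ℓ) (*-mono-≤ {1} {suc ℓ} {1} (s≤s z≤n) (≤-trans 0<ℓ (m≤m+n ℓ _))) ⟩
    suc ℓ * (suc ℓ * (3 * ℓ))          ≤⟨ m≤m+n _ _ ⟩
    2 * (suc ℓ * (suc ℓ * (3 * ℓ)))    ≤⟨ large ⟩
    d                                  ∎
    where open ≤-Reasoning

  no-odd : ∀ {s t k vs} → R s t → SP s t k vs → odd k ≡ true → ⊥
  no-odd {k = k} r P o with SP⇒Path P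
  ... | p , P′ , refl , refl , _ = no-odd-link free k p o P′ r

  R-nbrs : ∀ v → ∃₂ λ x y → Adj v x × Adj v y × x ≢ y × R x y
  R-nbrs v with freshes (adj G v) v (suc ℓ) [] (≤-trans ℓ<d (≤-reflexive (sym (regular v))))
  ... | x , good , inj with R-pair x
  ...   | i , j , i<j , j≤ℓ , r =
    x i , x j , proj₁ (good i (m≤n⇒m≤1+n (≤-trans i<j j≤ℓ))) , proj₁ (good j (s≤s j≤ℓ)) , inj i j i<j (s≤s j≤ℓ) , r

  open Subsets G using (Proper)
  open Colouring G d regular R R-sym no-odd R-nbrs

  coloured : ∃ (Proper (λ _ → true))
  -- At the start all degrees are `d`, so any vertex may be named as the exception.
  coloured = colour (suc (count {n} λ _ → true)) (λ _ → true) v₀ ≤-refl λ {v} _ _ → subst (d ∣_) (sym (regular v)) ∣-refl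

odd-order⇒even-degree : ∀ {n} (G : Graph n) d → (∀ v → count (adj G v) ≡ d) → odd n ≡ true → odd d ≡ false
odd-order⇒even-degree {n} G d regular o
  with handshake (λ u v → ⟦ adj G u v ⟧) (λ u v → cong ⟦_⟧ (symmetric G u v)) (λ v → cong ⟦_⟧ (loopless G v))
... | k , e = trans (sym (cong (_∧ odd d) o)) (trans (sym (odd-* n d))
  (trans (cong odd (trans (sym (trans (sum-cong-≗ regular) (sum-const n d))) e)) (odd-double k)))

-- The threshold and the two parities of the order.

module _ (ℓ : ℕ) (3≤ℓ : 3 ≤ ℓ) where

  -- `X` is the degree demanded by `Dense`. For `n ≥ M * X` the density condition implies `X ≤ d`;
  -- moreover `n / M ≥ X ≥ 2ℓ`, so the remainder of `n` modulo `M` fits into a class of the blow-up.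
  X M N : ℕ
  X = 2 * (suc ℓ * (suc ℓ * (3 * ℓ)))
  M = suc (2 * ℓ)
  N = M * X

  0<ℓ : 0 < ℓ
  0<ℓ = ≤-trans (s≤s z≤n) 3≤ℓ

  2ℓ≤X : 2 * ℓ ≤ X
  2ℓ≤X = *-monoʳ-≤ 2 (begin
    ℓ                         ≤⟨ m≤m+n ℓ _ ⟩
    3 * ℓ                     ≤⟨ m≤m+n _ _ ⟩
    suc ℓ * (3 * ℓ)           ≤⟨ m≤m+n _ _ ⟩
    suc ℓ * (suc ℓ * (3 * ℓ)) ∎)
    where open ≤-Reasoning

  0<X : 0 < X
  0<X = ≤-trans 0<ℓ (≤-trans (m≤m+n ℓ _) 2ℓ≤X)

  0<N : 0 < N
  0<N = ≤-trans 0<X (m≤m+n X _)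

  module _ (n : ℕ) (N≤n : N ≤ n) where

    bipartite : ∀ d (G : Graph n) → Regular d G → ¬ ContainsCycleSuc (2 * ℓ ∸ 2) G → 2 * n < M * d →
                ∃ λ k → n ≡ k + k × d ≤ k
    bipartite d G reg free dense = dense⇒bipartite G ℓ d 3≤ℓ (fromℕ< (≤-trans 0<N N≤n))
      (λ v → trans (sym (degree≡count G v)) (reg v)) dense
      (<⇒≤ (*-cancelˡ-< M X d (≤-trans (s≤s (≤-trans N≤n (m≤m+n n _))) dense))) free

    even-case : n % 2 ≡ 0 → IsRegTuranCycle n (2 * ℓ ∸ 2) (n / 2)
    even-case e = subst (Example ℓ (n / 2)) (sym n≡)
        (mkExample {ℓ} 3≤ℓ (parityGraph (n / 2 * 2)) _ (λ v → parityGraph-degree (n / 2) (odd (toℕ v))) (parityGraph-near M)) ,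
      upper
      where
      n≡ : n ≡ n / 2 * 2
      n≡ = trans (m≡m%n+[m/n]*n n 2) (cong (_+ n / 2 * 2) e)
      upper : ∀ d (G : Graph n) → Regular d G → ¬ ContainsCycleSuc (2 * ℓ ∸ 2) G → d ≤ n / 2
      upper d G reg free = ≮⇒≥ λ n/2<d → too-large n/2<d (bipartite d G reg free (dense n/2<d))
        where
        dense : n / 2 < d → 2 * n < M * d
        dense n/2<d = begin-strict
          2 * n             ≡⟨ cong (2 *_) n≡ ⟩
          2 * (n / 2 * 2)   ≡⟨ quadruple (n / 2) ⟩
          4 * (n / 2)       <⟨ *-monoʳ-< 4 n/2<d ⟩
          4 * d             ≤⟨ *-monoˡ-≤ d (≤-trans (n≤1+n 4) (≤-trans (n≤1+n 5) (≤-trans (*-monoʳ-≤ 2 3≤ℓ) (n≤1+n _)))) ⟩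
          M * d             ∎
          where
          open ≤-Reasoning
          quadruple : ∀ q → 2 * (q * 2) ≡ 4 * q
          quadruple = solve-∀
        too-large : n / 2 < d → (∃ λ k → n ≡ k + k × d ≤ k) → ⊥
        too-large n/2<d (k , n≡k+k , d≤k) = <⇒≱ n/2<d (≤-trans d≤k
          (≤-reflexive (sym (trans (cong (_/ 2) (trans n≡k+k (twice k))) (m*n/n≡m k 2)))))
          where
          twice : ∀ k → k + k ≡ k * 2
          twice = solve-∀

    odd-case : n % 2 ≡ 1 → IsRegTuranCycle n (2 * ℓ ∸ 2) (2 * (n / M))
    odd-case o = subst₂ (Example ℓ) (cong (q +_) (sym (+-identityʳ q))) (sym (m≡m%n+[m/n]*n n M))
        (blowUp-example ℓ 3≤ℓ q (n % M) (≤-trans 0<X X≤q) (≤-trans (s≤s⁻¹ (m%n<n n M)) (≤-trans 2ℓ≤X X≤q))) ,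
      upper
      where
      q = n / M
      X≤q : X ≤ q
      X≤q = ≤-trans (≤-reflexive (sym (m*n/n≡m X M))) (/-monoˡ-≤ M (≤-trans (≤-reflexive (*-comm X M)) N≤n))
      n-odd : odd n ≡ true
      n-odd = trans (cong odd (trans (m≡m%n+[m/n]*n n 2) (cong (_+ n / 2 * 2) o)))
        (cong not (trans (odd-* (n / 2) 2) (∧-zero (odd (n / 2)))))
        where
        ∧-zero : ∀ b → b ∧ false ≡ false
        ∧-zero true  = refl
        ∧-zero false = refl
      upper : ∀ d (G : Graph n) → Regular d G → ¬ ContainsCycleSuc (2 * ℓ ∸ 2) G → d ≤ 2 * q
      upper d G reg free = ≮⇒≥ λ 2q<d → too-large d G reg free 2q<d
          (half d (odd-order⇒even-degree G d (λ v → trans (sym (degree≡count G v)) (reg v)) n-odd))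
        where
        not-double : ∀ {d} → (∃ λ k → n ≡ k + k × d ≤ k) → ⊥
        not-double (k , n≡k+k , _) = contradiction (trans (sym n-odd) (trans (cong odd n≡k+k) (odd-double k))) λ ()
        too-large : ∀ d (G : Graph n) → Regular d G → ¬ ContainsCycleSuc (2 * ℓ ∸ 2) G → 2 * q < d →
                    (∃ λ h → d ≡ h + h) → ⊥
        too-large d G reg free 2q<d (h , refl) = not-double {d} (bipartite d G reg free dense)
          where
          -- As `d` is even, `2q < d` improves to `d ≥ 2(q + 1)`, and `(q + 1)M` exceeds `n`. This
          -- jump by 2 is what reaches the density condition.
          q<h : q < h
          q<h = *-cancelˡ-< 2 q h (≤-trans 2q<d (≤-reflexive (cong (h +_) (sym (+-identityʳ h)))))
          n<hM : n < h * M
          n<hM = begin-strict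
            n             ≡⟨ m≡m%n+[m/n]*n n M ⟩
            n % M + q * M <⟨ +-monoˡ-< (q * M) (m%n<n n M) ⟩
            suc q * M     ≤⟨ *-monoˡ-≤ M q<h ⟩
            h * M         ∎
            where open ≤-Reasoning
          dense : 2 * n < M * (h + h)
          dense = ≤-trans (*-monoʳ-< 2 n<hM) (≤-reflexive (twice h M))
            where
            twice : ∀ h M → 2 * (h * M) ≡ M * (h + h)
            twice = solve-∀

theorem1 : (ℓ : ℕ) → 3 ≤ ℓ →
    Σ ℕ λ N → (n : ℕ) → N ≤ n →
    (n % 2 ≡ 0 → IsRegTuranCycle n (2 * ℓ ∸ 2) (n / 2))
    × (n % 2 ≡ 1 → IsRegTuranCycle n (2 * ℓ ∸ 2) (2 * (n / suc (2 * ℓ))))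
theorem1 ℓ 3≤ℓ = N ℓ 3≤ℓ , λ n N≤n → even-case ℓ 3≤ℓ n N≤n , odd-case ℓ 3≤ℓ n N≤n
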